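{- The randomized marking algorithm for classical unweighted paging is $O(\log k)$-competitive: there is an absolute constant $C$ such that for every cache size $k\ge 1$ and every finite page universe there is a constant $b$, independent of the number of page requests, such that for every request sequence $\sigma$, $$\mathbb E[\mathrm{cost}_{RM}(\sigma)]\le C\ln(1+k)\cdot \mathrm{cost}_{OPT}(\sigma)+b,$$ where $RM$ is the randomized marking algorithm and $\mathrm{cost}_{OPT}(\sigma)$ is the minimum cost of an offline algorithm on $\sigma$.
   Context: Unweighted paging: a cache holds $k$ pages; pages $p_1,p_2,\dots$ are requested one by one; if the requested page is not in the cache, the algorithm pays 1 and must bring it into the cache by evicting another page. An offline algorithm knows the whole request sequence in advance. Randomized marking ($RM$): initially all pages in the cache are unmarked. When $p_t$ is requested: if $p_t$ is in the cache, it is marked and nothing else changes. If $p_t$ is not in the cache, a page chosen uniformly at random from the unmarked pages currently in the cache is evicted, and $p_t$ is brought into the cache and marked. If such an eviction is needed but there are no unmarked pages left in the cache, the current phase ends: all pages in the cache become unmarked, a new phase begins, and the request is processed in the new phase. -}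

module Defs where

open import Data.Fin using (Fin)
open import Data.Fin.Subset
  using (Subset; _∈_; _∉_; _∪_; _─_; _-_; ⁅_⁆; ⊥; Nonempty)
open import Data.Fin.Subset.Properties
  using (_∈?_; nonempty?; x∈⁅x⁆; q⊆p∪q)
open import Data.Integer as ℤ using (+_; -[1+_])
open import Data.Integer.Properties as ℤP using ()
open import Data.List using (List; []; _∷_; [_]; map; concatMap; filter; foldr; length; allFin)
open import Data.List.Extrema.Nat using (argmin; f[argmin]≤f[xs]; argmin-all)
open import Data.List.Membership.Propositional using () renaming (_∈_ to _∈ˡ_)
open import Data.List.Membership.Propositional.Properties
  using (∈-allFin; ∈-filter⁺)
open import Data.List.Relation.Unary.All as All using ()
open import Data.List.Relation.Unary.All.Properties using (all-filter)
open import Data.Nat as ℕ using (ℕ; zero; suc)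
open import Data.Nat.Properties as ℕP using ()
open import Data.Nat.Solver using (module +-*-Solver)
open import Data.Product using (Σ; ∃; _×_; _,_; proj₁; proj₂)
open import Data.Rational as ℚ using (ℚ; mkℚ; 0ℚ; 1ℚ; ½; _/_; ∣_∣)
open import Data.Rational.Properties as ℚP using ()
open import Data.Rational.Solver using () renaming (module +-*-Solver to ℚSolver)
open import Data.Rational.Unnormalised as ℚᵘ using (mkℚᵘ)
open import Data.Rational.Unnormalised.Properties as ℚᵘP using ()
open import Data.Sum using (inj₁; inj₂)
open import Relation.Binary.PropositionalEquality
  using (_≡_; refl; sym; trans; cong; cong₂; subst; subst₂)
open import Relation.Nullary using (yes; no; contradiction)

IsCauchy : (ℕ → ℚ) → Set
IsCauchy s = ∀ (ε : ℚ) → 0ℚ ℚ.< ε →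
  ∃ λ N → ∀ m n → N ℕ.≤ m → N ℕ.≤ n → ∣ s m ℚ.- s n ∣ ℚ.≤ ε

record ℝ : Set where
  constructor real
  field
    seq    : ℕ → ℚ
    cauchy : IsCauchy seq

open ℝ public

infix 4 _≤ℝ_

_≤ℝ_ : ℝ → ℝ → Set
x ≤ℝ y = ∀ (ε : ℚ) → 0ℚ ℚ.< ε →
  ∃ λ N → ∀ n → N ℕ.≤ n → seq x n ℚ.≤ seq y n ℚ.+ ε

private

  |-|≤ : ∀ {p q ε} → p ℚ.≤ q ℚ.+ ε → q ℚ.≤ p ℚ.+ ε → ∣ p ℚ.- q ∣ ℚ.≤ ε
  |-|≤ {p} {q} {ε} p≤q+ε q≤p+ε with ℚP.∣p∣≡p∨∣p∣≡-p (p ℚ.- q)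
  ... | inj₁ eq = begin
    ∣ p ℚ.- q ∣            ≡⟨ eq ⟩
    p ℚ.- q                ≤⟨ ℚP.+-monoˡ-≤ (ℚ.- q) p≤q+ε ⟩
    q ℚ.+ ε ℚ.- q          ≡⟨ solve 2 (λ q ε → q :+ ε :- q := ε) refl q ε ⟩
    ε                      ∎
    where open ℚP.≤-Reasoning
          open ℚSolver
  ... | inj₂ eq = begin
    ∣ p ℚ.- q ∣            ≡⟨ eq ⟩
    ℚ.- (p ℚ.- q)          ≡⟨ solve 2 (λ p q → :- (p :- q) := q :- p) refl p q ⟩
    q ℚ.- p                ≤⟨ ℚP.+-monoˡ-≤ (ℚ.- p) q≤p+ε ⟩
    p ℚ.+ ε ℚ.- p          ≡⟨ solve 2 (λ p ε → p :+ ε :- p := ε) refl p ε ⟩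
    ε                      ∎
    where open ℚP.≤-Reasoning
          open ℚSolver

  0<½* : ∀ {ε} → 0ℚ ℚ.< ε → 0ℚ ℚ.< ½ ℚ.* ε
  0<½* {ε} 0<ε = subst (ℚ._< ½ ℚ.* ε) (ℚP.*-zeroʳ ½) (ℚP.*-monoʳ-<-pos ½ 0<ε)

  ½+½ : ∀ ε → ½ ℚ.* ε ℚ.+ ½ ℚ.* ε ≡ ε
  ½+½ ε = trans (sym (ℚP.*-distribʳ-+ ε ½ ½)) (ℚP.*-identityˡ ε)

fromℚ : ℚ → ℝ
fromℚ q = real (λ _ → q) λ ε 0<ε →
  0 , λ _ _ _ _ → subst (ℚ._≤ ε) (cong ∣_∣ (sym (ℚP.+-inverseʳ q))) (ℚP.<⇒≤ 0<ε)

fromℕ : ℕ → ℝ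
fromℕ n = fromℚ (+ n / 1)

infixl 6 _+ℝ_
infixl 7 _*ℝ_

_+ℝ_ : ℝ → ℝ → ℝ
x +ℝ y = real (λ n → seq x n ℚ.+ seq y n) λ ε 0<ε →
  let
    (N₁ , p) = cauchy x (½ ℚ.* ε) (0<½* 0<ε)
    (N₂ , q) = cauchy y (½ ℚ.* ε) (0<½* 0<ε)
  in N₁ ℕ.⊔ N₂ , λ m n N≤m N≤n →
    let
      x-x = p m n (ℕP.≤-trans (ℕP.m≤m⊔n N₁ N₂) N≤m) (ℕP.≤-trans (ℕP.m≤m⊔n N₁ N₂) N≤n)
      y-y = q m n (ℕP.≤-trans (ℕP.m≤n⊔m N₁ N₂) N≤m) (ℕP.≤-trans (ℕP.m≤n⊔m N₁ N₂) N≤n)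
    in begin
      ∣ seq x m ℚ.+ seq y m ℚ.- (seq x n ℚ.+ seq y n) ∣
        ≡⟨ cong ∣_∣ (solve 4 (λ a b c d → a :+ b :- (c :+ d) := (a :- c) :+ (b :- d))
             refl (seq x m) (seq y m) (seq x n) (seq y n)) ⟩
      ∣ (seq x m ℚ.- seq x n) ℚ.+ (seq y m ℚ.- seq y n) ∣
        ≤⟨ ℚP.∣p+q∣≤∣p∣+∣q∣ (seq x m ℚ.- seq x n) (seq y m ℚ.- seq y n) ⟩
      ∣ seq x m ℚ.- seq x n ∣ ℚ.+ ∣ seq y m ℚ.- seq y n ∣
        ≤⟨ ℚP.+-mono-≤ x-x y-y ⟩
      ½ ℚ.* ε ℚ.+ ½ ℚ.* ε
        ≡⟨ ½+½ ε ⟩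
      ε ∎
  where open ℚP.≤-Reasoning
        open ℚSolver

private

  0<1 : 0ℚ ℚ.< 1ℚ
  0<1 = ℚP.positive⁻¹ 1ℚ

  bound : ∀ x → ∃ λ N → ∃ λ B → ℚ.Positive B × (∀ n → N ℕ.≤ n → ∣ seq x n ∣ ℚ.≤ B)
  bound x =
    let (N , p) = cauchy x 1ℚ 0<1
        a = seq x N
    in N , ∣ a ∣ ℚ.+ 1ℚ
         , ℚ.positive (ℚP.+-mono-≤-< (ℚP.0≤∣p∣ a) 0<1)
         , λ n N≤n → begin
      ∣ seq x n ∣
        ≡⟨ cong ∣_∣ (solve 2 (λ a b → b := a :+ (b :- a)) refl a (seq x n)) ⟩
      ∣ a ℚ.+ (seq x n ℚ.- a) ∣        ≤⟨ ℚP.∣p+q∣≤∣p∣+∣q∣ a (seq x n ℚ.- a) ⟩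
      ∣ a ∣ ℚ.+ ∣ seq x n ℚ.- a ∣       ≤⟨ ℚP.+-monoʳ-≤ ∣ a ∣ (p n N N≤n ℕP.≤-refl) ⟩
      ∣ a ∣ ℚ.+ 1ℚ                      ∎
    where open ℚP.≤-Reasoning
          open ℚSolver

  -- Given B > 0, some δ > 0 has B δ = ε.
  quotient : ∀ B → ℚ.Positive B → ∀ ε → 0ℚ ℚ.< ε → ∃ λ δ → 0ℚ ℚ.< δ × B ℚ.* δ ≡ ε
  quotient B B>0 ε 0<ε = B⁻¹ ℚ.* ε , 0<δ , Bδ≡ε
    where
    instance
      B-pos : ℚ.Positive B
      B-pos = B>0
      B≢0 : ℚ.NonZero B
      B≢0 = ℚP.pos⇒nonZero B
    B⁻¹ = ℚ.1/ B
    instance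
      B⁻¹-pos : ℚ.Positive B⁻¹
      B⁻¹-pos = ℚP.1/pos⇒pos B
    0<δ : 0ℚ ℚ.< B⁻¹ ℚ.* ε
    0<δ = subst (ℚ._< B⁻¹ ℚ.* ε) (ℚP.*-zeroʳ B⁻¹) (ℚP.*-monoʳ-<-pos B⁻¹ 0<ε)
    Bδ≡ε : B ℚ.* (B⁻¹ ℚ.* ε) ≡ ε
    Bδ≡ε = trans (sym (ℚP.*-assoc B B⁻¹ ε))
             (trans (cong (ℚ._* ε) (ℚP.*-inverseʳ B)) (ℚP.*-identityˡ ε))

  *-mono-∣∣ : ∀ {p q B δ} → ℚ.Positive B →
              ∣ p ∣ ℚ.≤ B → ∣ q ∣ ℚ.≤ δ → ∣ p ℚ.* q ∣ ℚ.≤ B ℚ.* δ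
  *-mono-∣∣ {p} {q} {B} {δ} B>0 p≤B q≤δ = begin
    ∣ p ℚ.* q ∣      ≡⟨ ℚP.∣p*q∣≡∣p∣*∣q∣ p q ⟩
    ∣ p ∣ ℚ.* ∣ q ∣  ≤⟨ ℚP.*-monoʳ-≤-nonNeg ∣ q ∣ {{ℚP.∣-∣-nonNeg q}} p≤B ⟩
    B ℚ.* ∣ q ∣      ≤⟨ ℚP.*-monoˡ-≤-nonNeg B {{ℚP.pos⇒nonNeg B {{B>0}}}} q≤δ ⟩
    B ℚ.* δ          ∎
    where open ℚP.≤-Reasoning

_*ℝ_ : ℝ → ℝ → ℝ
x *ℝ y = real (λ n → seq x n ℚ.* seq y n) λ ε 0<ε →
  let
    (Nx , Bx , Bx>0 , x≤Bx) = bound x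
    (Ny , By , By>0 , y≤By) = bound y
    (δx , δx>0 , Bxδx) = quotient Bx Bx>0 (½ ℚ.* ε) (0<½* 0<ε)
    (δy , δy>0 , Byδy) = quotient By By>0 (½ ℚ.* ε) (0<½* 0<ε)
    (N₁ , p) = cauchy x δy δy>0
    (N₂ , q) = cauchy y δx δx>0
    N = (Nx ℕ.⊔ Ny) ℕ.⊔ (N₁ ℕ.⊔ N₂)
    Nx≤N = ℕP.≤-trans (ℕP.m≤m⊔n Nx Ny) (ℕP.m≤m⊔n (Nx ℕ.⊔ Ny) (N₁ ℕ.⊔ N₂))
    Ny≤N = ℕP.≤-trans (ℕP.m≤n⊔m Nx Ny) (ℕP.m≤m⊔n (Nx ℕ.⊔ Ny) (N₁ ℕ.⊔ N₂))
    N₁≤N = ℕP.≤-trans (ℕP.m≤m⊔n N₁ N₂) (ℕP.m≤n⊔m (Nx ℕ.⊔ Ny) (N₁ ℕ.⊔ N₂))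
    N₂≤N = ℕP.≤-trans (ℕP.m≤n⊔m N₁ N₂) (ℕP.m≤n⊔m (Nx ℕ.⊔ Ny) (N₁ ℕ.⊔ N₂))
  in N , λ m n N≤m N≤n →
    let
      a = seq x m ; b = seq y m ; c = seq x n ; d = seq y n
      x-x = p m n (ℕP.≤-trans N₁≤N N≤m) (ℕP.≤-trans N₁≤N N≤n)
      y-y = q m n (ℕP.≤-trans N₂≤N N≤m) (ℕP.≤-trans N₂≤N N≤n)
    in begin
      ∣ a ℚ.* b ℚ.- c ℚ.* d ∣
        ≡⟨ cong ∣_∣ (solve 4 (λ a b c d → a :* b :- c :* d := a :* (b :- d) :+ d :* (a :- c))
             refl a b c d) ⟩
      ∣ a ℚ.* (b ℚ.- d) ℚ.+ d ℚ.* (a ℚ.- c) ∣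
        ≤⟨ ℚP.∣p+q∣≤∣p∣+∣q∣ (a ℚ.* (b ℚ.- d)) (d ℚ.* (a ℚ.- c)) ⟩
      ∣ a ℚ.* (b ℚ.- d) ∣ ℚ.+ ∣ d ℚ.* (a ℚ.- c) ∣
        ≤⟨ ℚP.+-mono-≤
             (*-mono-∣∣ Bx>0 (x≤Bx m (ℕP.≤-trans Nx≤N N≤m)) y-y)
             (*-mono-∣∣ By>0 (y≤By n (ℕP.≤-trans Ny≤N N≤n)) x-x) ⟩
      Bx ℚ.* δx ℚ.+ By ℚ.* δy
        ≡⟨ cong₂ ℚ._+_ Bxδx Byδy ⟩
      ½ ℚ.* ε ℚ.+ ½ ℚ.* ε
        ≡⟨ ½+½ ε ⟩
      ε ∎
  where open ℚP.≤-Reasoning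
        open ℚSolver

-- The natural logarithm of a positive integer, as ∫₁ˣ dt/t.

∑ : ℕ → (ℕ → ℚ) → ℚ
∑ zero    f = 0ℚ
∑ (suc n) f = ∑ n f ℚ.+ f n

-- The left Riemann sum of 1/t over [1 , x] with mesh 1/M, where M = 1 + m:
-- the j-th rectangle has area (1/M) · 1/(1 + j/M) = 1/(M + j), and there are
-- M (x - 1) rectangles.
riemann : ℕ → ℕ → ℚ
riemann x m = ∑ (suc m ℕ.* ℕ.pred x) λ j → + 1 / (suc m ℕ.+ j)

private

  u : ℕ → ℚ
  u n = + 1 / suc n

  toℚᵘ-u : ∀ n → ℚ.toℚᵘ (u n) ℚᵘ.≃ mkℚᵘ (+ 1) n
  toℚᵘ-u n = ℚP.toℚᵘ-fromℚᵘ (mkℚᵘ (+ 1) n)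

  u-anti : ∀ {m n} → m ℕ.≤ n → u n ℚ.≤ u m
  u-anti {m} {n} m≤n = ℚP.toℚᵘ-cancel-≤ (begin
    ℚ.toℚᵘ (u n)  ≃⟨ toℚᵘ-u n ⟩
    mkℚᵘ (+ 1) n  ≤⟨ ℚᵘ.*≤* (ℤP.*-monoˡ-≤-nonNeg (+ 1) (ℤ.+≤+ (ℕ.s≤s m≤n))) ⟩
    mkℚᵘ (+ 1) m  ≃⟨ toℚᵘ-u m ⟨
    ℚ.toℚᵘ (u m)  ∎)
    where open ℚᵘP.≤-Reasoning

  u-nonneg : ∀ n → 0ℚ ℚ.≤ u n
  u-nonneg n = ℚP.nonNegative⁻¹ (u n) {{ℚP.normalize-nonNeg 1 (suc n)}}

  ∑-mono : ∀ n {f g} → (∀ i → i ℕ.< n → f i ℚ.≤ g i) → ∑ n f ℚ.≤ ∑ n g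
  ∑-mono zero    f≤g = ℚP.≤-refl
  ∑-mono (suc n) f≤g =
    ℚP.+-mono-≤ (∑-mono n (λ i i<n → f≤g i (ℕP.m<n⇒m<1+n i<n))) (f≤g n ℕP.≤-refl)

  ∑-cong : ∀ n {f g} → (∀ i → f i ≡ g i) → ∑ n f ≡ ∑ n g
  ∑-cong zero    f≡g = refl
  ∑-cong (suc n) f≡g = cong₂ ℚ._+_ (∑-cong n f≡g) (f≡g n)

  ∑-split : ∀ m n f → ∑ (m ℕ.+ n) f ≡ ∑ m f ℚ.+ ∑ n (λ i → f (m ℕ.+ i))
  ∑-split m zero    f rewrite ℕP.+-identityʳ m = sym (ℚP.+-identityʳ (∑ m f))
  ∑-split m (suc n) f rewrite ℕP.+-suc m n | ∑-split m n f =
    ℚP.+-assoc (∑ m f) _ _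

  ∑-blocks : ∀ a N f → ∑ (a ℕ.* N) f ≡ ∑ a (λ j → ∑ N (λ i → f (j ℕ.* N ℕ.+ i)))
  ∑-blocks zero    N f = refl
  ∑-blocks (suc a) N f
    rewrite ℕP.+-comm N (a ℕ.* N) | ∑-split (a ℕ.* N) N f | ∑-blocks a N f = refl

  ∑-const : ∀ n q → ∑ n (λ _ → q) ≡ (+ n / 1) ℚ.* q
  ∑-const zero    q = sym (ℚP.*-zeroˡ q)
  ∑-const (suc n) q = trans (cong (ℚ._+ q) (∑-const n q)) (trans
    (cong (((+ n / 1) ℚ.* q) ℚ.+_) (sym (ℚP.*-identityˡ q)))
    (trans (sym (ℚP.*-distribʳ-+ q (+ n / 1) 1ℚ)) (cong (ℚ._* q) n+1)))
    where
    open ℚᵘP.≤-Reasoning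
    n+1 : (+ n / 1) ℚ.+ 1ℚ ≡ + suc n / 1
    n+1 = ℚP.toℚᵘ-injective (begin-equality
      ℚ.toℚᵘ ((+ n / 1) ℚ.+ 1ℚ)           ≃⟨ ℚP.toℚᵘ-homo-+ (+ n / 1) 1ℚ ⟩
      ℚ.toℚᵘ (+ n / 1) ℚᵘ.+ ℚ.toℚᵘ 1ℚ
        ≃⟨ ℚᵘP.+-cong (ℚP.toℚᵘ-fromℚᵘ (mkℚᵘ (+ n) 0)) (ℚᵘP.≃-refl {ℚ.toℚᵘ 1ℚ}) ⟩
      mkℚᵘ (+ n) 0 ℚᵘ.+ mkℚᵘ (+ 1) 0
        ≃⟨ ℚᵘ.*≡* (cong (ℤ._* + 1) (trans
             (cong (ℤ._+ + 1) (ℤP.*-identityʳ (+ n))) (cong +_ (ℕP.+-comm n 1)))) ⟩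
      mkℚᵘ (+ suc n) 0                    ≃⟨ ℚP.toℚᵘ-fromℚᵘ (mkℚᵘ (+ suc n) 0) ⟨
      ℚ.toℚᵘ (+ suc n / 1)                ∎)

  N*u : ∀ n a c → suc c ≡ suc a ℕ.* suc n → ∑ (suc n) (λ _ → u c) ≡ u a
  N*u n a c eq = trans (∑-const (suc n) (u c)) (ℚP.toℚᵘ-injective (begin-equality
    ℚ.toℚᵘ ((+ suc n / 1) ℚ.* u c)            ≃⟨ ℚP.toℚᵘ-homo-* (+ suc n / 1) (u c) ⟩
    ℚ.toℚᵘ (+ suc n / 1) ℚᵘ.* ℚ.toℚᵘ (u c)
      ≃⟨ ℚᵘP.*-cong (ℚP.toℚᵘ-fromℚᵘ (mkℚᵘ (+ suc n) 0)) (toℚᵘ-u c) ⟩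
    mkℚᵘ (+ suc n) 0 ℚᵘ.* mkℚᵘ (+ 1) c        ≃⟨ ℚᵘ.*≡* (cong +_ nat) ⟩
    mkℚᵘ (+ 1) a                              ≃⟨ toℚᵘ-u a ⟨
    ℚ.toℚᵘ (u a)                              ∎))
    where
    open ℚᵘP.≤-Reasoning
    nat : suc n ℕ.* 1 ℕ.* suc a ≡ 1 ℕ.* (1 ℕ.* suc c)
    nat = trans (cong (ℕ._* suc a) (ℕP.*-identityʳ (suc n)))
      (trans (ℕP.*-comm (suc n) (suc a)) (trans (sym eq)
        (sym (trans (ℕP.*-identityˡ (1 ℕ.* suc c)) (ℕP.*-identityˡ (suc c))))))

  module _ (k m n : ℕ) where

    private
      r = n ℕ.+ m ℕ.* suc n

      g : ℕ → ℚ
      g i = u (r ℕ.+ i)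

      den : ∀ a j → suc (n ℕ.+ a ℕ.* suc n ℕ.+ j ℕ.* suc n) ≡ suc (a ℕ.+ j) ℕ.* suc n
      den a j = solve 3 (λ n a j →
        con 1 :+ (n :+ a :* (con 1 :+ n) :+ j :* (con 1 :+ n))
          := (con 1 :+ (a :+ j)) :* (con 1 :+ n)) refl n a j
        where open +-*-Solver

      fine : ∑ (suc r ℕ.* k) g ≡ ∑ (suc m ℕ.* k) (λ j → ∑ (suc n) (λ i → g (j ℕ.* suc n ℕ.+ i)))
      fine = trans (cong (λ z → ∑ z g) size) (∑-blocks (suc m ℕ.* k) (suc n) g)
        where
        open +-*-Solver
        size : suc r ℕ.* k ≡ suc m ℕ.* k ℕ.* suc n
        size = solve 3 (λ k m n →
          (con 1 :+ (n :+ m :* (con 1 :+ n))) :* k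
            := (con 1 :+ m) :* k :* (con 1 :+ n)) refl k m n

    refine≤ : ∑ (suc r ℕ.* k) g ℚ.≤ ∑ (suc m ℕ.* k) (λ j → u (m ℕ.+ j))
    refine≤ = ℚP.≤-trans (ℚP.≤-reflexive fine) (∑-mono (suc m ℕ.* k) λ j _ →
      ℚP.≤-trans
        (∑-mono (suc n) λ i _ → u-anti (ℕP.+-monoʳ-≤ r (ℕP.m≤m+n (j ℕ.* suc n) i)))
        (ℚP.≤-reflexive (N*u n (m ℕ.+ j) (r ℕ.+ j ℕ.* suc n) (den m j))))

    ≤refine : ∑ (suc m ℕ.* k) (λ j → u (m ℕ.+ suc j)) ℚ.≤ ∑ (suc r ℕ.* k) g
    ≤refine = ℚP.≤-trans (∑-mono (suc m ℕ.* k) λ j _ →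
      ℚP.≤-trans
        (ℚP.≤-reflexive (sym (N*u n (m ℕ.+ suc j) (r ℕ.+ suc j ℕ.* suc n) (den m (suc j)))))
        (∑-mono (suc n) λ i i<N → u-anti (ℕP.+-monoʳ-≤ r
          (ℕP.≤-trans (ℕP.+-monoʳ-≤ (j ℕ.* suc n) (ℕP.<⇒≤ i<N))
            (ℕP.≤-reflexive (ℕP.+-comm (j ℕ.* suc n) (suc n)))))))
      (ℚP.≤-reflexive (sym fine))

  ∑-shift : ∀ A (f : ℕ → ℚ) → (∀ i → 0ℚ ℚ.≤ f i) → ∑ A f ℚ.≤ ∑ A (λ j → f (suc j)) ℚ.+ f 0
  ∑-shift A f f≥0 = begin
    ∑ A f                              ≡⟨ ℚP.+-identityʳ (∑ A f) ⟨
    ∑ A f ℚ.+ 0ℚ                       ≤⟨ ℚP.+-monoʳ-≤ (∑ A f) (f≥0 A) ⟩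
    ∑ (1 ℕ.+ A) f                      ≡⟨ ∑-split 1 A f ⟩
    ∑ 1 f ℚ.+ ∑ A (λ j → f (suc j))    ≡⟨ ℚP.+-comm (∑ 1 f) _ ⟩
    ∑ A (λ j → f (suc j)) ℚ.+ ∑ 1 f
      ≡⟨ cong (∑ A (λ j → f (suc j)) ℚ.+_) (ℚP.+-identityˡ (f 0)) ⟩
    ∑ A (λ j → f (suc j)) ℚ.+ f 0      ∎
    where open ℚP.≤-Reasoning

  riemann-step : ∀ x m n → riemann x m ℚ.≤ riemann x n ℚ.+ u m
  riemann-step x m n = begin
    riemann x m
      ≤⟨ ∑-shift (suc m ℕ.* k) (λ j → u (m ℕ.+ j)) (λ j → u-nonneg (m ℕ.+ j)) ⟩
    ∑ (suc m ℕ.* k) (λ j → u (m ℕ.+ suc j)) ℚ.+ u (m ℕ.+ 0)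
      ≤⟨ ℚP.+-mono-≤ (≤refine k m n) (u-anti (ℕP.m≤m+n m 0)) ⟩
    riemann x (n ℕ.+ m ℕ.* suc n) ℚ.+ u m
      ≡⟨ cong (λ z → riemann x z ℚ.+ u m) (ℕP.suc-injective (ℕP.*-comm (suc m) (suc n))) ⟩
    riemann x (m ℕ.+ n ℕ.* suc m) ℚ.+ u m
      ≤⟨ ℚP.+-monoˡ-≤ (u m) (refine≤ k n m) ⟩
    riemann x n ℚ.+ u m ∎
    where open ℚP.≤-Reasoning
          k = ℕ.pred x

  archimedes : ∀ ε → 0ℚ ℚ.< ε → ∃ λ N → u N ℚ.≤ ε
  archimedes (mkℚ (+ 0) d _)     (ℚ.*<* (ℤ.+<+ ()))
  archimedes (mkℚ -[1+ _ ] d _)  (ℚ.*<* ())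
  archimedes ε@(mkℚ (+ suc a) d _) _ = d , ℚP.toℚᵘ-cancel-≤ (begin
    ℚ.toℚᵘ (u d)        ≃⟨ toℚᵘ-u d ⟩
    mkℚᵘ (+ 1) d        ≤⟨ ℚᵘ.*≤* (ℤP.*-monoʳ-≤-nonNeg (+ suc d)
                             (ℤ.+≤+ (ℕ.s≤s (ℕ.z≤n {a})))) ⟩
    mkℚᵘ (+ suc a) d    ∎)
    where open ℚᵘP.≤-Reasoning

ln : (x : ℕ) → .{{ℕ.NonZero x}} → ℝ
ln x = real (riemann x) λ ε 0<ε →
  let (N , uN≤ε) = archimedes ε 0<ε
      close = λ m n (N≤m : N ℕ.≤ m) → ℚP.≤-trans (riemann-step x m n)
        (ℚP.+-monoʳ-≤ (riemann x n) (ℚP.≤-trans (u-anti N≤m) uN≤ε))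
  in N , λ m n N≤m N≤n → |-|≤ (close m n N≤m) (close n m N≤n)

-- Finitely supported probability distributions, as lists of weighted
-- outcomes.

Dist : Set → Set
Dist A = List (ℚ × A)

return : ∀ {A} → A → Dist A
return x = [ (1ℚ , x) ]

infixl 1 _>>=_

_>>=_ : ∀ {A B} → Dist A → (A → Dist B) → Dist B
d >>= f = concatMap (λ (w , x) → map (λ (v , y) → (w ℚ.* v , y)) (f x)) d

-- Only the uniform distribution on a nonempty list is a probability
-- distribution.
uniform : ∀ {A} → List A → Dist A
uniform []         = []
uniform xs@(_ ∷ ys) = map (λ x → (+ 1 / suc (length ys) , x)) xs

𝔼 : Dist ℕ → ℚ
𝔼 = foldr (λ (w , x) s → w ℚ.* (+ x / 1) ℚ.+ s) 0ℚ

-- Paging over the page universe Fin n.  A cache of size k is a subset with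
-- exactly k elements; every fault replaces one cached page.

module _ {n : ℕ} where

  Page : Set
  Page = Fin n

  elements : Subset n → List Page
  elements S = filter (_∈? S) (allFin n)

  replace : Subset n → Page → Page → Subset n
  replace S q p = (S - q) ∪ ⁅ p ⁆

  -- The ways an offline algorithm can serve a request sequence from cache S.
  data Schedule (S : Subset n) : List Page → Set where
    done  : Schedule S []
    hit   : ∀ {p σ} → p ∈ S → Schedule S σ → Schedule S (p ∷ σ)
    fault : ∀ {p σ} → p ∉ S → (q : Page) → q ∈ S →
            Schedule (replace S q p) σ → Schedule S (p ∷ σ)

  cost : ∀ {S σ} → Schedule S σ → ℕ
  cost done            = 0
  cost (hit _ s)       = cost s
  cost (fault _ _ _ s) = suc (cost s)

  IsOptCost : Subset n → List Page → ℕ → Set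
  IsOptCost S σ c = (∃ λ (s : Schedule S σ) → cost s ≡ c)
                  × (∀ (s : Schedule S σ) → c ℕ.≤ cost s)

  record State : Set where
    constructor ⟨_,_⟩
    field
      cache  : Subset n
      marked : Subset n

  open State public

  initial : Subset n → State
  initial S = ⟨ S , ⊥ ⟩

  unmarked : State → Subset n
  unmarked s = cache s ─ marked s

  newPhaseIfNeeded : State → State
  newPhaseIfNeeded s with nonempty? (unmarked s)
  ... | yes _ = s
  ... | no  _ = ⟨ cache s , ⊥ ⟩

  -- Outcomes pair the cost paid with the next state.
  step : State → Page → Dist (ℕ × State)
  step s p with p ∈? cache s
  ... | yes _ = return (0 , ⟨ cache s , marked s ∪ ⁅ p ⁆ ⟩)
  ... | no  _ =
    let s′ = newPhaseIfNeeded s in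
    uniform (elements (unmarked s′)) >>= λ q →
    return (1 , ⟨ replace (cache s′) q p , marked s′ ∪ ⁅ p ⁆ ⟩)

  costRM : State → List Page → Dist ℕ
  costRM s []      = return 0
  costRM s (p ∷ σ) =
    step s p        >>= λ (c , s′) →
    costRM s′ σ     >>= λ c′ →
    return (c ℕ.+ c′)

  optCost-exists : ∀ S → Nonempty S → ∀ σ → ∃ λ c → IsOptCost S σ c
  optCost-exists S ne [] = 0 , (done , refl) , λ { done → ℕ.z≤n }
  optCost-exists S ne (p ∷ σ) with p ∈? S
  ... | yes p∈S =
    let (c , (s , eq) , least) = optCost-exists S ne σ in
    c , (hit p∈S s , eq) , λ { (hit _ s′)        → least s′
                             ; (fault p∉S _ _ _) → contradiction p∈S p∉S }
  ... | no p∉S =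
    suc (f q*) , (fault p∉S q* q*∈S (proj₁ (proj₁ (proj₂ (rec q*))))
                 , cong suc (proj₂ (proj₁ (proj₂ (rec q*)))))
    , λ { (hit p∈S _)        → contradiction p∈S p∉S
        ; (fault _ q q∈S s′) → ℕ.s≤s (ℕP.≤-trans
            (All.lookup (f[argmin]≤f[xs] {f = f} (proj₁ ne) (elements S))
              (∈-filter⁺ (_∈? S) (∈-allFin q) q∈S))
            (proj₂ (proj₂ (rec q)) s′)) }
    where
    rec : ∀ q → ∃ λ c → IsOptCost (replace S q p) σ c
    rec q = optCost-exists (replace S q p) (p , q⊆p∪q (S - q) ⁅ p ⁆ (x∈⁅x⁆ p)) σ
    f : Page → ℕ
    f q = proj₁ (rec q)
    q* : Page
    q* = argmin f (proj₁ ne) (elements S)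
    q*∈S : q* ∈ S
    q*∈S = argmin-all f {P = _∈ S} (proj₂ ne) (all-filter (_∈? S) (allFin n))

{-# OPTIONS --safe #-}

-- Within a phase the set M of marked pages evolves deterministically.  When u
-- pages are unmarked and an unmarked page p is requested, charge H u (the u-th
-- harmonic number) if p was not cached at the start of the phase.  A fault
-- with u unmarked pages evicts a uniformly random one, which creates, for each
-- page requested later in the phase when i < u pages are unmarked, a new
-- charge H i with probability at most 1/u; as 1 + (H 1 + ⋯ + H (u-1)) / u = H u,
-- the expected cost of marking is at most the sum of the charges.  A schedule
-- of cost c forces at most 2c charges: with P the cache at the start of the
-- phase and T the offline cache, the potential |T ─ (P ∪ M)| + |M ─ T| drops
-- at every charge on an offline hit and rises by at most 1 per offline fault.  Finally
-- H k ≤ 2 ln (1 + k), as the Riemann sums dominate 1/2 + ⋯ + 1/(k+1).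

module Submission where

open import Defs
open import Data.Nat using (ℕ; suc; _≤_)
open import Data.Fin using (Fin)
open import Data.Fin.Subset using (Subset; ∣_∣)
open import Data.List using (List)
open import Data.Product using (∃; ∃-syntax)
open import Relation.Binary.PropositionalEquality using (_≡_)

open import Data.Fin using (zero; suc)
open import Data.Fin.Properties using (_≟_)
open import Data.Fin.Subset
  using (inside; outside; _∈_; _∉_; _⊆_; _∪_; _─_; _-_; ⁅_⁆; ⊥)
open import Data.Fin.Subset.Properties
open import Data.Integer as ℤ using (+_)
open import Data.Integer.Properties as ℤP using ()
open import Data.List using ([]; _∷_; _++_; map; foldr; length; tabulate; filter; allFin)
open import Data.List.Membership.Propositional using () renaming (_∈_ to _∈ˡ_)
open import Data.List.Membership.Propositional.Properties using (∈-filter⁻)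
open import Data.List.Relation.Unary.All as All using (All; []; _∷_)
open import Data.List.Relation.Unary.Any using (here; there)
open import Data.List.Relation.Unary.AllPairs using ([]; _∷_)
open import Data.List.Relation.Unary.Unique.Propositional using (Unique)
open import Data.List.Relation.Unary.Unique.Propositional.Properties using (allFin⁺; filter⁺)
open import Data.Nat as ℕ using (zero; _<_; z≤n; s≤s)
open import Data.Nat.Properties as ℕP using ()
open import Data.Nat.Solver using () renaming (module +-*-Solver to ℕSolver)
open import Data.Product using (_×_; _,_; proj₁; proj₂)
open import Data.Rational as ℚ using (ℚ; 0ℚ; 1ℚ; _/_)
open import Data.Rational.Properties as ℚP using ()
open import Data.Rational.Solver using () renaming (module +-*-Solver to ℚSolver)
open import Data.Rational.Unnormalised as ℚᵘ using (mkℚᵘ)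
open import Data.Rational.Unnormalised.Properties as ℚᵘP using ()
open import Data.Sum using (inj₁; inj₂)
open import Data.Vec using ([]; _∷_; here; there)
open import Function using (_∘_; id)
open import Relation.Binary.PropositionalEquality
  using (_≢_; refl; sym; trans; cong; cong₂; subst; module ≡-Reasoning)
open import Relation.Nullary using (yes; no; contradiction)

-- Natural numbers and their reciprocals as rationals

ι : ℕ → ℚ
ι n = + n / 1

recip : ℕ → ℚ
recip n = + 1 / suc n

toℚᵘ-ι : ∀ n → ℚ.toℚᵘ (ι n) ℚᵘ.≃ mkℚᵘ (+ n) 0
toℚᵘ-ι n = ℚP.toℚᵘ-fromℚᵘ (mkℚᵘ (+ n) 0)

toℚᵘ-recip : ∀ n → ℚ.toℚᵘ (recip n) ℚᵘ.≃ mkℚᵘ (+ 1) n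
toℚᵘ-recip n = ℚP.toℚᵘ-fromℚᵘ (mkℚᵘ (+ 1) n)

ι-homo-+ : ∀ m n → ι (m ℕ.+ n) ≡ ι m ℚ.+ ι n
ι-homo-+ m n = ℚP.toℚᵘ-injective (begin-equality
  ℚ.toℚᵘ (ι (m ℕ.+ n))              ≃⟨ toℚᵘ-ι (m ℕ.+ n) ⟩
  mkℚᵘ (+ (m ℕ.+ n)) 0
    ≃⟨ ℚᵘ.*≡* (cong (ℤ._* + 1) (sym (cong₂ ℤ._+_ (ℤP.*-identityʳ (+ m)) (ℤP.*-identityʳ (+ n))))) ⟩
  mkℚᵘ (+ m) 0 ℚᵘ.+ mkℚᵘ (+ n) 0    ≃⟨ ℚᵘP.+-cong (toℚᵘ-ι m) (toℚᵘ-ι n) ⟨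
  ℚ.toℚᵘ (ι m) ℚᵘ.+ ℚ.toℚᵘ (ι n)    ≃⟨ ℚP.toℚᵘ-homo-+ (ι m) (ι n) ⟨
  ℚ.toℚᵘ (ι m ℚ.+ ι n)              ∎)
  where open ℚᵘP.≤-Reasoning

ι-suc : ∀ n → ι (suc n) ≡ 1ℚ ℚ.+ ι n
ι-suc = ι-homo-+ 1

ι-nonNeg : ∀ n → ℚ.NonNegative (ι n)
ι-nonNeg n = ℚP.normalize-nonNeg n 1

0≤ι : ∀ n → 0ℚ ℚ.≤ ι n
0≤ι n = ℚP.nonNegative⁻¹ (ι n) {{ι-nonNeg n}}

0≤recip : ∀ n → 0ℚ ℚ.≤ recip n
0≤recip n = ℚP.nonNegative⁻¹ (recip n) {{ℚP.normalize-nonNeg 1 (suc n)}}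

p≤q+p : ∀ {q} p → 0ℚ ℚ.≤ q → p ℚ.≤ q ℚ.+ p
p≤q+p {q} p 0≤q = subst (ℚ._≤ q ℚ.+ p) (ℚP.+-identityˡ p) (ℚP.+-monoˡ-≤ p 0≤q)

p≤q+r⇒p≤s+q+r : ∀ {p q r s} → 0ℚ ℚ.≤ s → p ℚ.≤ q ℚ.+ r → p ℚ.≤ s ℚ.+ q ℚ.+ r
p≤q+r⇒p≤s+q+r {p} {q} {r} {s} 0≤s p≤q+r = ℚP.≤-trans p≤q+r
  (ℚP.+-monoˡ-≤ r (p≤q+p q 0≤s))

p≤q+r⇒s+p≤t+q+[s+r] : ∀ {p q r t} s → 0ℚ ℚ.≤ t → p ℚ.≤ q ℚ.+ r →
  s ℚ.+ p ℚ.≤ t ℚ.+ q ℚ.+ (s ℚ.+ r)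
p≤q+r⇒s+p≤t+q+[s+r] {p} {q} {r} {t} s 0≤t p≤q+r = begin
  s ℚ.+ p                    ≤⟨ ℚP.+-monoʳ-≤ s (p≤q+r⇒p≤s+q+r 0≤t p≤q+r) ⟩
  s ℚ.+ (t ℚ.+ q ℚ.+ r)
    ≡⟨ solve 3 (λ s u r → s :+ (u :+ r) := u :+ (s :+ r)) refl s (t ℚ.+ q) r ⟩
  t ℚ.+ q ℚ.+ (s ℚ.+ r)      ∎
  where
  open ℚP.≤-Reasoning
  open ℚSolver

ι-mono : ∀ {m n} → m ≤ n → ι m ℚ.≤ ι n
ι-mono {m} {n} m≤n = begin
  ι m                       ≤⟨ p≤q+p (ι m) (0≤ι (n ℕ.∸ m)) ⟩
  ι (n ℕ.∸ m) ℚ.+ ι m       ≡⟨ ι-homo-+ (n ℕ.∸ m) m ⟨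
  ι (n ℕ.∸ m ℕ.+ m)         ≡⟨ cong ι (ℕP.m∸n+n≡m m≤n) ⟩
  ι n                       ∎
  where open ℚP.≤-Reasoning

ι*recip : ∀ n → ι (suc n) ℚ.* recip n ≡ 1ℚ
ι*recip n = ℚP.toℚᵘ-injective (begin-equality
  ℚ.toℚᵘ (ι (suc n) ℚ.* recip n)               ≃⟨ ℚP.toℚᵘ-homo-* (ι (suc n)) (recip n) ⟩
  ℚ.toℚᵘ (ι (suc n)) ℚᵘ.* ℚ.toℚᵘ (recip n)     ≃⟨ ℚᵘP.*-cong (toℚᵘ-ι (suc n)) (toℚᵘ-recip n) ⟩
  mkℚᵘ (+ suc n) 0 ℚᵘ.* mkℚᵘ (+ 1) n
    ≃⟨ ℚᵘ.*≡* (cong +_ (ℕSolver.solve 1 (λ n →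
         (con 1 :+ n) :* con 1 :* con 1 := con 1 :* (con 1 :* (con 1 :+ n))) refl n)) ⟩
  mkℚᵘ (+ 1) 0                                 ∎)
  where open ℚᵘP.≤-Reasoning
        open ℕSolver

recip-anti : ∀ {m n} → m ≤ n → recip n ℚ.≤ recip m
recip-anti {m} {n} m≤n = ℚP.toℚᵘ-cancel-≤ (begin
  ℚ.toℚᵘ (recip n)  ≃⟨ toℚᵘ-recip n ⟩
  mkℚᵘ (+ 1) n      ≤⟨ ℚᵘ.*≤* (ℤP.*-monoˡ-≤-nonNeg (+ 1) (ℤ.+≤+ (s≤s m≤n))) ⟩
  mkℚᵘ (+ 1) m      ≃⟨ toℚᵘ-recip m ⟨
  ℚ.toℚᵘ (recip m)  ∎)
  where open ℚᵘP.≤-Reasoning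

-- Harmonic numbers and the logarithm

H : ℕ → ℚ
H zero    = 0ℚ
H (suc n) = recip n ℚ.+ H n

0≤H : ∀ n → 0ℚ ℚ.≤ H n
0≤H zero    = ℚP.≤-refl
0≤H (suc n) = ℚP.+-mono-≤ (0≤recip n) (0≤H n)

H-mono : ∀ {m n} → m ≤ n → H m ℚ.≤ H n
H-mono {m} m≤n = go (ℕP.≤⇒≤′ m≤n)
  where
  go : ∀ {n} → m ℕ.≤′ n → H m ℚ.≤ H n
  go (ℕ.≤′-reflexive refl)        = ℚP.≤-refl
  go {n = suc n} (ℕ.≤′-step m≤′n) = ℚP.≤-trans (go m≤′n) (p≤q+p (H n) (0≤recip n))

sumH : ℕ → ℚ
sumH zero    = 0ℚ
sumH (suc n) = H (suc n) ℚ.+ sumH n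

0≤sumH : ∀ u → 0ℚ ℚ.≤ sumH u
0≤sumH zero    = ℚP.≤-refl
0≤sumH (suc u) = ℚP.+-mono-≤ (0≤H (suc u)) (0≤sumH u)

-- The identity 1 + (H 1 + ⋯ + H n) / (n + 1) = H (n + 1), cleared of denominators. It balances the
-- books in `fault-≤`: the unit paid for the fault plus the average of the charges it creates is
-- exactly the charge made.
sumH-closed : ∀ n → ι (suc n) ℚ.+ sumH n ≡ ι (suc n) ℚ.* H (suc n)
sumH-closed zero    = refl
sumH-closed (suc n) = begin
  ι (2 ℕ.+ n) ℚ.+ (h ℚ.+ sumH n)
    ≡⟨ cong (ℚ._+ (h ℚ.+ sumH n)) (ι-suc (suc n)) ⟩
  1ℚ ℚ.+ ι (suc n) ℚ.+ (h ℚ.+ sumH n)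
    ≡⟨ solve 4 (λ o a h s → o :+ a :+ (h :+ s) := o :+ (h :+ (a :+ s)))
         refl 1ℚ (ι (suc n)) h (sumH n) ⟩
  1ℚ ℚ.+ (h ℚ.+ (ι (suc n) ℚ.+ sumH n))
    ≡⟨ cong (λ z → 1ℚ ℚ.+ (h ℚ.+ z)) (sumH-closed n) ⟩
  1ℚ ℚ.+ (h ℚ.+ ι (suc n) ℚ.* h)
    ≡⟨ cong₂ ℚ._+_ (sym (ι*recip (suc n)))
         (solve 2 (λ a h → h :+ a :* h := (con 1ℚ :+ a) :* h) refl (ι (suc n)) h) ⟩
  ι (2 ℕ.+ n) ℚ.* recip (suc n) ℚ.+ (1ℚ ℚ.+ ι (suc n)) ℚ.* h
    ≡⟨ cong (λ z → ι (2 ℕ.+ n) ℚ.* recip (suc n) ℚ.+ z ℚ.* h) (sym (ι-suc (suc n))) ⟩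
  ι (2 ℕ.+ n) ℚ.* recip (suc n) ℚ.+ ι (2 ℕ.+ n) ℚ.* h
    ≡⟨ ℚP.*-distribˡ-+ (ι (2 ℕ.+ n)) (recip (suc n)) h ⟨
  ι (2 ℕ.+ n) ℚ.* H (2 ℕ.+ n) ∎
  where
  open ≡-Reasoning
  open ℚSolver
  h = H (suc n)

ι-homo-* : ∀ m n → ι (m ℕ.* n) ≡ ι m ℚ.* ι n
ι-homo-* zero    n = sym (ℚP.*-zeroˡ (ι n))
ι-homo-* (suc m) n = begin
  ι (n ℕ.+ m ℕ.* n)          ≡⟨ ι-homo-+ n (m ℕ.* n) ⟩
  ι n ℚ.+ ι (m ℕ.* n)        ≡⟨ cong (ι n ℚ.+_) (ι-homo-* m n) ⟩
  ι n ℚ.+ ι m ℚ.* ι n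
    ≡⟨ solve 2 (λ m n → n :+ m :* n := (con 1ℚ :+ m) :* n) refl (ι m) (ι n) ⟩
  (1ℚ ℚ.+ ι m) ℚ.* ι n       ≡⟨ cong (ℚ._* ι n) (ι-suc m) ⟨
  ι (suc m) ℚ.* ι n          ∎
  where
  open ≡-Reasoning
  open ℚSolver

ι*recip-cancel : ∀ m a c → suc c ≡ suc m ℕ.* suc a → ι (suc m) ℚ.* recip c ≡ recip a
ι*recip-cancel m a c eq = begin
  ι (suc m) ℚ.* recip c
    ≡⟨ ℚP.*-identityʳ _ ⟨
  ι (suc m) ℚ.* recip c ℚ.* 1ℚ
    ≡⟨ cong (ι (suc m) ℚ.* recip c ℚ.*_) (sym (ι*recip a)) ⟩
  ι (suc m) ℚ.* recip c ℚ.* (ι (suc a) ℚ.* recip a)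
    ≡⟨ solve 4 (λ m c a r → m :* c :* (a :* r) := m :* a :* c :* r)
         refl (ι (suc m)) (recip c) (ι (suc a)) (recip a) ⟩
  ι (suc m) ℚ.* ι (suc a) ℚ.* recip c ℚ.* recip a
    ≡⟨ cong (λ z → z ℚ.* recip c ℚ.* recip a)
         (trans (sym (ι-homo-* (suc m) (suc a))) (cong ι (sym eq))) ⟩
  ι (suc c) ℚ.* recip c ℚ.* recip a
    ≡⟨ cong (ℚ._* recip a) (ι*recip c) ⟩
  1ℚ ℚ.* recip a
    ≡⟨ ℚP.*-identityˡ (recip a) ⟩
  recip a ∎
  where
  open ≡-Reasoning
  open ℚSolver

-- Source of the factor 2 between `H` and the logarithm: the Riemann sums yield the terms 1/2, 1/3,
-- ..., whereas `H` starts one term earlier, at 1.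
recip≤2*recip : ∀ n → recip n ℚ.≤ ι 2 ℚ.* recip (suc n)
recip≤2*recip n = ℚP.toℚᵘ-cancel-≤ (begin
  ℚ.toℚᵘ (recip n)       ≃⟨ toℚᵘ-recip n ⟩
  mkℚᵘ (+ 1) n           ≤⟨ ℚᵘ.*≤* (ℤ.+≤+ (ℕP.≤-trans (ℕP.m≤m+n _ n) (ℕP.≤-reflexive nat))) ⟩
  mkℚᵘ (+ 2) 0 ℚᵘ.* mkℚᵘ (+ 1) (suc n)
                         ≃⟨ ℚᵘP.*-cong (toℚᵘ-ι 2) (toℚᵘ-recip (suc n)) ⟨
  ℚ.toℚᵘ (ι 2) ℚᵘ.* ℚ.toℚᵘ (recip (suc n))
                         ≃⟨ ℚP.toℚᵘ-homo-* (ι 2) (recip (suc n)) ⟨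
  ℚ.toℚᵘ (ι 2 ℚ.* recip (suc n)) ∎)
  where
  open ℚᵘP.≤-Reasoning
  open ℕSolver
  nat : 1 ℕ.* (1 ℕ.* suc (suc n)) ℕ.+ n ≡ 2 ℕ.* 1 ℕ.* suc n
  nat = solve 1 (λ n → con 1 :* (con 1 :* (con 2 :+ n)) :+ n
                    := con 2 :* con 1 :* (con 1 :+ n)) refl n

∑-≥ : ∀ a n f q → (∀ i → i < n → q ℚ.≤ f (a ℕ.+ i)) → ∑ a f ℚ.+ ι n ℚ.* q ℚ.≤ ∑ (a ℕ.+ n) f
∑-≥ a zero f q q≤f rewrite ℕP.+-identityʳ a =
  ℚP.≤-reflexive (trans (cong (∑ a f ℚ.+_) (ℚP.*-zeroˡ q)) (ℚP.+-identityʳ (∑ a f)))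
∑-≥ a (suc n) f q q≤f rewrite ℕP.+-suc a n = begin
  ∑ a f ℚ.+ ι (suc n) ℚ.* q            ≡⟨ cong (λ z → ∑ a f ℚ.+ z ℚ.* q) (ι-suc n) ⟩
  ∑ a f ℚ.+ (1ℚ ℚ.+ ι n) ℚ.* q
    ≡⟨ solve 3 (λ s n q → s :+ (con 1ℚ :+ n) :* q := s :+ n :* q :+ q) refl (∑ a f) (ι n) q ⟩
  ∑ a f ℚ.+ ι n ℚ.* q ℚ.+ q
    ≤⟨ ℚP.+-mono-≤ (∑-≥ a n f q (λ i i<n → q≤f i (ℕP.m<n⇒m<1+n i<n))) (q≤f n ℕP.≤-refl) ⟩
  ∑ (a ℕ.+ n) f ℚ.+ f (a ℕ.+ n)        ∎
  where
  open ℚP.≤-Reasoning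
  open ℚSolver

-- The k-th block of suc m terms of the Riemann sum has terms at least
-- 1 / ((k + 2)(m + 1)), hence sum at least 1 / (k + 2).
riemann-suc : ∀ k m → riemann (suc k) m ℚ.+ recip (suc k) ℚ.≤ riemann (suc (suc k)) m
riemann-suc k m = begin
  ∑ (suc m ℕ.* k) f ℚ.+ recip (suc k)
    ≡⟨ cong (∑ (suc m ℕ.* k) f ℚ.+_) (sym (ι*recip-cancel m (suc k) c refl)) ⟩
  ∑ (suc m ℕ.* k) f ℚ.+ ι (suc m) ℚ.* recip c
    ≤⟨ ∑-≥ (suc m ℕ.* k) (suc m) f (recip c) (λ i i<m → recip-anti (bound i i<m)) ⟩
  ∑ (suc m ℕ.* k ℕ.+ suc m) f
    ≡⟨ cong (λ z → ∑ z f) (trans (ℕP.+-comm (suc m ℕ.* k) (suc m)) (sym (ℕP.*-suc (suc m) k))) ⟩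
  ∑ (suc m ℕ.* suc k) f ∎
  where
  open ℚP.≤-Reasoning
  f = λ j → + 1 / (suc m ℕ.+ j)
  c = suc k ℕ.+ m ℕ.* suc (suc k)
  bound : ∀ i → i < suc m → m ℕ.+ (suc m ℕ.* k ℕ.+ i) ≤ c
  bound i (s≤s i≤m) = ℕP.≤-trans
    (ℕP.+-monoʳ-≤ m (ℕP.+-monoʳ-≤ (suc m ℕ.* k) (ℕP.m≤n⇒m≤1+n i≤m)))
    (ℕP.≤-reflexive (solve 2 (λ k m →
      m :+ ((con 1 :+ m) :* k :+ (con 1 :+ m)) := (con 1 :+ k) :+ m :* (con 2 :+ k)) refl k m))
    where open ℕSolver

-- Term by term: lengthening the interval by one unit adds at least 1/(k + 2) to the left sum, half
-- of which already exceeds no less than what twice that amount must cover, namely the term 1/(k +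
-- 1) of `H`. The bound holds at every mesh, so the comparison with `ln` needs no limit.
H≤2*riemann : ∀ k m → H k ℚ.≤ ι 2 ℚ.* riemann (suc k) m
H≤2*riemann zero m rewrite ℕP.*-zeroʳ m = ℚP.≤-refl
H≤2*riemann (suc k) m = begin
  recip k ℚ.+ H k
    ≤⟨ ℚP.+-mono-≤ (recip≤2*recip k) (H≤2*riemann k m) ⟩
  ι 2 ℚ.* recip (suc k) ℚ.+ ι 2 ℚ.* riemann (suc k) m
    ≡⟨ solve 3 (λ t a b → t :* a :+ t :* b := t :* (b :+ a)) refl
         (ι 2) (recip (suc k)) (riemann (suc k) m) ⟩
  ι 2 ℚ.* (riemann (suc k) m ℚ.+ recip (suc k))
    ≤⟨ ℚP.*-monoˡ-≤-nonNeg (ι 2) (riemann-suc k m) ⟩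
  ι 2 ℚ.* riemann (suc (suc k)) m ∎
  where
  open ℚP.≤-Reasoning
  open ℚSolver

-- Expectations over weighted lists

sumOver : ∀ {A : Set} → List A → (A → ℚ) → ℚ
sumOver xs f = foldr (λ x s → f x ℚ.+ s) 0ℚ xs

sumOver-mono : ∀ {A : Set} (xs : List A) {f g} →
  (∀ {x} → x ∈ˡ xs → f x ℚ.≤ g x) → sumOver xs f ℚ.≤ sumOver xs g
sumOver-mono []       f≤g = ℚP.≤-refl
sumOver-mono (x ∷ xs) f≤g = ℚP.+-mono-≤ (f≤g (here refl)) (sumOver-mono xs (f≤g ∘ there))

sumOver-+ : ∀ {A : Set} (xs : List A) f g →
  sumOver xs (λ x → f x ℚ.+ g x) ≡ sumOver xs f ℚ.+ sumOver xs g
sumOver-+ []       f g = refl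
sumOver-+ (x ∷ xs) f g = trans (cong (f x ℚ.+ g x ℚ.+_) (sumOver-+ xs f g))
  (solve 4 (λ a b c d → a :+ b :+ (c :+ d) := a :+ c :+ (b :+ d)) refl
    (f x) (g x) (sumOver xs f) (sumOver xs g))
  where open ℚSolver

sumOver-const : ∀ {A : Set} (xs : List A) q → sumOver xs (λ _ → q) ≡ ι (length xs) ℚ.* q
sumOver-const []       q = sym (ℚP.*-zeroˡ q)
sumOver-const (x ∷ xs) q = begin
  q ℚ.+ sumOver xs (λ _ → q)       ≡⟨ cong (q ℚ.+_) (sumOver-const xs q) ⟩
  q ℚ.+ ι (length xs) ℚ.* q
    ≡⟨ solve 2 (λ n q → q :+ n :* q := (con 1ℚ :+ n) :* q) refl (ι (length xs)) q ⟩
  (1ℚ ℚ.+ ι (length xs)) ℚ.* q     ≡⟨ cong (ℚ._* q) (ι-suc (length xs)) ⟨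
  ι (suc (length xs)) ℚ.* q        ∎
  where
  open ≡-Reasoning
  open ℚSolver

sumOver-0 : ∀ {A : Set} (qs : List A) → sumOver qs (λ _ → 0ℚ) ≡ 0ℚ
sumOver-0 qs = trans (sumOver-const qs 0ℚ) (ℚP.*-zeroʳ (ι (length qs)))

-- At the integrand `ι` this unfolds to `𝔼`. Other integrands are needed in order to carry a cost
-- paid earlier through the recursion.
expect : ∀ {A : Set} → Dist A → (A → ℚ) → ℚ
expect d f = sumOver d λ (w , x) → w ℚ.* f x

expect-++ : ∀ {A : Set} (d e : Dist A) f → expect (d ++ e) f ≡ expect d f ℚ.+ expect e f
expect-++ []            e f = sym (ℚP.+-identityˡ (expect e f))
expect-++ ((w , x) ∷ d) e f =
  trans (cong (w ℚ.* f x ℚ.+_) (expect-++ d e f)) (sym (ℚP.+-assoc (w ℚ.* f x) _ _))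

expect-scale : ∀ {A : Set} w (d : Dist A) f →
  expect (map (λ (v , y) → (w ℚ.* v , y)) d) f ≡ w ℚ.* expect d f
expect-scale w []            f = sym (ℚP.*-zeroʳ w)
expect-scale w ((v , y) ∷ d) f = trans (cong (w ℚ.* v ℚ.* f y ℚ.+_) (expect-scale w d f))
  (solve 4 (λ w v y e → w :* v :* y :+ w :* e := w :* (v :* y :+ e)) refl w v (f y) (expect d f))
  where open ℚSolver

expect->>= : ∀ {A B : Set} (d : Dist A) (g : A → Dist B) f →
  expect (d >>= g) f ≡ expect d (λ x → expect (g x) f)
expect->>= []            g f = refl
expect->>= ((w , x) ∷ d) g f = trans
  (expect-++ (map (λ (v , y) → (w ℚ.* v , y)) (g x)) (d >>= g) f)
  (cong₂ ℚ._+_ (expect-scale w (g x) f) (expect->>= d g f))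

expect-return : ∀ {A : Set} (x : A) f → expect (return x) f ≡ f x
expect-return x f = trans (ℚP.+-identityʳ (1ℚ ℚ.* f x)) (ℚP.*-identityˡ (f x))

expect-cong : ∀ {A : Set} (d : Dist A) {f g} → (∀ x → f x ≡ g x) → expect d f ≡ expect d g
expect-cong []            f≡g = refl
expect-cong ((w , x) ∷ d) f≡g = cong₂ ℚ._+_ (cong (w ℚ.*_) (f≡g x)) (expect-cong d f≡g)

expect-uniform : ∀ {A : Set} {n} (xs : List A) f → length xs ≡ suc n →
  expect (uniform xs) f ≡ recip n ℚ.* sumOver xs f
expect-uniform (x ∷ xs) f refl = go (x ∷ xs)
  where
  w = recip (length xs)
  -- The weight stays that of the full list while the recursion shortens the list.
  go : ∀ ys → expect (map (λ y → (w , y)) ys) f ≡ w ℚ.* sumOver ys f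
  go []       = sym (ℚP.*-zeroʳ w)
  go (y ∷ ys) = trans (cong (w ℚ.* f y ℚ.+_) (go ys)) (sym (ℚP.*-distribˡ-+ w (f y) _))

expect-uniform-≤ : ∀ {A : Set} {n} (xs : List A) f B → length xs ≡ suc n →
  sumOver xs f ℚ.≤ ι (suc n) ℚ.* B → expect (uniform xs) f ℚ.≤ B
expect-uniform-≤ {n = n} xs f B len≡ ∑≤ = begin
  expect (uniform xs) f             ≡⟨ expect-uniform xs f len≡ ⟩
  recip n ℚ.* sumOver xs f          ≤⟨ ℚP.*-monoˡ-≤-nonNeg (recip n) {{ℚP.normalize-nonNeg 1 (suc n)}} ∑≤ ⟩
  recip n ℚ.* (ι (suc n) ℚ.* B)
    ≡⟨ solve 3 (λ r n b → r :* (n :* b) := n :* r :* b) refl (recip n) (ι (suc n)) B ⟩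
  ι (suc n) ℚ.* recip n ℚ.* B       ≡⟨ cong (ℚ._* B) (ι*recip n) ⟩
  1ℚ ℚ.* B                          ≡⟨ ℚP.*-identityˡ B ⟩
  B                                 ∎
  where
  open ℚP.≤-Reasoning
  open ℚSolver

-- Finite subsets

x∈p─q⁻ : ∀ {n} {x : Fin n} (p q : Subset n) → x ∈ p ─ q → x ∈ p × x ∉ q
x∈p─q⁻ (inside  ∷ p) (outside ∷ q) here = here , λ ()
x∈p─q⁻ {x = zero} (inside  ∷ p) (inside  ∷ q) ()
x∈p─q⁻ {x = zero} (outside ∷ p) (inside  ∷ q) ()
x∈p─q⁻ {x = zero} (outside ∷ p) (outside ∷ q) ()
x∈p─q⁻ {x = suc x} (_ ∷ p) (_ ∷ q) (there x∈) =
  let (x∈p , x∉q) = x∈p─q⁻ p q x∈ in there x∈p , λ { (there x∈q) → x∉q x∈q }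

x∈p-y⁻ : ∀ {n} {x : Fin n} (p : Subset n) y → x ∈ p - y → x ∈ p × x ≢ y
x∈p-y⁻ p y x∈ with x∈p─q⁻ p ⁅ y ⁆ x∈
... | x∈p , x∉y = x∈p , x∉⁅y⁆⇒x≢y x∉y

x∈p⇒p∪x≡p : ∀ {n} {x : Fin n} {p} → x ∈ p → p ∪ ⁅ x ⁆ ≡ p
x∈p⇒p∪x≡p {x = x} {p} x∈p = ⊆-antisym sub (p⊆p∪q ⁅ x ⁆)
  where
  sub : p ∪ ⁅ x ⁆ ⊆ p
  sub y∈ with x∈p∪q⁻ p ⁅ x ⁆ y∈
  ... | inj₁ y∈p = y∈p
  ... | inj₂ y∈x rewrite x∈⁅y⁆⇒x≡y x y∈x = x∈p

x∈p⇒∣p∣≡1+∣p-x∣ : ∀ {n} {x : Fin n} {p} → x ∈ p → ∣ p ∣ ≡ suc ∣ p - x ∣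
x∈p⇒∣p∣≡1+∣p-x∣ {p = inside ∷ p} here = cong (suc ∘ ∣_∣) (sym (p─⊥≡p p))
x∈p⇒∣p∣≡1+∣p-x∣ {p = inside  ∷ p} (there x∈p) = cong suc (x∈p⇒∣p∣≡1+∣p-x∣ x∈p)
x∈p⇒∣p∣≡1+∣p-x∣ {p = outside ∷ p} (there x∈p) = x∈p⇒∣p∣≡1+∣p-x∣ x∈p

x∉p⇒∣p∪x∣≡1+∣p∣ : ∀ {n} {x : Fin n} {p} → x ∉ p → ∣ p ∪ ⁅ x ⁆ ∣ ≡ suc ∣ p ∣
x∉p⇒∣p∪x∣≡1+∣p∣ {x = x} {p} x∉p = trans
  (x∈p⇒∣p∣≡1+∣p-x∣ (q⊆p∪q p ⁅ x ⁆ (x∈⁅x⁆ x)))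
  (cong (suc ∘ ∣_∣) (⊆-antisym sub sup))
  where
  sub : p ∪ ⁅ x ⁆ - x ⊆ p
  sub y∈ with x∈p─q⁻ (p ∪ ⁅ x ⁆) ⁅ x ⁆ y∈
  ... | y∈∪ , y∉x with x∈p∪q⁻ p ⁅ x ⁆ y∈∪
  ...   | inj₁ y∈p = y∈p
  ...   | inj₂ y∈x = contradiction y∈x y∉x
  sup : p ⊆ p ∪ ⁅ x ⁆ - x
  sup y∈p = x∈p∧x≢y⇒x∈p-y (p⊆p∪q ⁅ x ⁆ y∈p) λ { refl → x∉p y∈p }

∣p∪x∣≤1+∣p∣ : ∀ {n} (p : Subset n) x → ∣ p ∪ ⁅ x ⁆ ∣ ≤ suc ∣ p ∣
∣p∪x∣≤1+∣p∣ p x with x ∈? p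
... | yes x∈p rewrite x∈p⇒p∪x≡p x∈p = ℕP.n≤1+n ∣ p ∣
... | no  x∉p = ℕP.≤-reflexive (x∉p⇒∣p∪x∣≡1+∣p∣ x∉p)

∣replace∣ : ∀ {n} {S : Subset n} {q p} → q ∈ S → p ∉ S → ∣ replace S q p ∣ ≡ ∣ S ∣
∣replace∣ {S = S} {q} q∈S p∉S = trans
  (x∉p⇒∣p∪x∣≡1+∣p∣ (p∉S ∘ p─q⊆p S ⁅ q ⁆)) (sym (x∈p⇒∣p∣≡1+∣p-x∣ q∈S))

-- Both sides count the union of `p` and `q`.
∣p∣+∣q─p∣≡∣q∣+∣p─q∣ : ∀ {n} (p q : Subset n) → ∣ p ∣ ℕ.+ ∣ q ─ p ∣ ≡ ∣ q ∣ ℕ.+ ∣ p ─ q ∣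
∣p∣+∣q─p∣≡∣q∣+∣p─q∣ []            []            = refl
∣p∣+∣q─p∣≡∣q∣+∣p─q∣ (inside  ∷ p) (inside  ∷ q) = cong suc (∣p∣+∣q─p∣≡∣q∣+∣p─q∣ p q)
∣p∣+∣q─p∣≡∣q∣+∣p─q∣ (inside  ∷ p) (outside ∷ q) =
  trans (cong suc (∣p∣+∣q─p∣≡∣q∣+∣p─q∣ p q)) (sym (ℕP.+-suc ∣ q ∣ _))
∣p∣+∣q─p∣≡∣q∣+∣p─q∣ (outside ∷ p) (inside  ∷ q) =
  trans (ℕP.+-suc ∣ p ∣ _) (cong suc (∣p∣+∣q─p∣≡∣q∣+∣p─q∣ p q))
∣p∣+∣q─p∣≡∣q∣+∣p─q∣ (outside ∷ p) (outside ∷ q) = ∣p∣+∣q─p∣≡∣q∣+∣p─q∣ p q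

∣p∣≡∣q∣⇒∣p─q∣≡∣q─p∣ : ∀ {n} (p q : Subset n) → ∣ p ∣ ≡ ∣ q ∣ → ∣ p ─ q ∣ ≡ ∣ q ─ p ∣
∣p∣≡∣q∣⇒∣p─q∣≡∣q─p∣ p q eq = sym (ℕP.+-cancelˡ-≡ (∣ p ∣) (∣ q ─ p ∣) (∣ p ─ q ∣)
  (trans (∣p∣+∣q─p∣≡∣q∣+∣p─q∣ p q) (cong (ℕ._+ ∣ p ─ q ∣) (sym eq))))

length-elements : ∀ {n} (S : Subset n) → length (elements S) ≡ ∣ S ∣
length-elements S = go S id λ _ → id , id
  where
  -- The recursion peels `S′` while the filter keeps testing membership in the whole of `S`; `f`
  -- sends the remaining indices to their original positions.
  go : ∀ {m} (S′ : Subset m) (f : Fin m → Fin _) →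
    (∀ i → (i ∈ S′ → f i ∈ S) × (f i ∈ S → i ∈ S′)) →
    length (filter (_∈? S) (tabulate f)) ≡ ∣ S′ ∣
  go []       f f-∈ = refl
  go (b ∷ S′) f f-∈ with f zero ∈? S | b
  ... | yes f0∈ | inside  = cong suc (go S′ (f ∘ suc) λ i →
          (λ i∈ → proj₁ (f-∈ (suc i)) (there i∈)) , λ fi∈ → drop-there (proj₂ (f-∈ (suc i)) fi∈))
  ... | no  f0∉ | outside = go S′ (f ∘ suc) λ i →
          (λ i∈ → proj₁ (f-∈ (suc i)) (there i∈)) , λ fi∈ → drop-there (proj₂ (f-∈ (suc i)) fi∈)
  ... | yes f0∈ | outside = contradiction (proj₂ (f-∈ zero) f0∈) λ ()
  ... | no  f0∉ | inside  = contradiction (proj₁ (f-∈ zero) here) f0∉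

-- Charges

weigh : List ℕ → ℚ
weigh is = sumOver is H

module _ {n : ℕ} where

  point : Fin n → ℚ → Fin n → ℚ
  point p w q with q ≟ p
  ... | yes _ = w
  ... | no  _ = 0ℚ

  -- The additional charge incurred in the current phase if q is missing.
  evictionCharge : ℕ → Subset n → List (Fin n) → Fin n → ℚ
  evictionCharge zero    M σ       q = 0ℚ
  evictionCharge (suc u) M []      q = 0ℚ
  evictionCharge (suc u) M (p ∷ σ) q with p ∈? M
  ... | yes _ = evictionCharge (suc u) M σ q
  ... | no  _ = point p (H (suc u)) q ℚ.+ evictionCharge u (M ∪ ⁅ p ⁆) σ q

  0≤point : ∀ p {w} q → 0ℚ ℚ.≤ w → 0ℚ ℚ.≤ point p w q
  0≤point p q 0≤w with q ≟ p
  ... | yes _ = 0≤w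
  ... | no  _ = ℚP.≤-refl

  sumOver-point-∉ : ∀ {p w} {qs} → All (p ≢_) qs → sumOver qs (point p w) ≡ 0ℚ
  sumOver-point-∉ [] = refl
  sumOver-point-∉ {p} (_∷_ {q} p≢q p∉qs) with q ≟ p
  ... | yes q≡p = contradiction (sym q≡p) p≢q
  ... | no  _   = trans (ℚP.+-identityˡ _) (sumOver-point-∉ p∉qs)

  sumOver-point : ∀ {p w qs} → 0ℚ ℚ.≤ w → Unique qs → sumOver qs (point p w) ℚ.≤ w
  sumOver-point 0≤w [] = 0≤w
  sumOver-point {p} {w} 0≤w (_∷_ {q} q∉qs qs!) with q ≟ p
  ... | yes refl = ℚP.≤-reflexive (trans (cong (w ℚ.+_) (sumOver-point-∉ q∉qs)) (ℚP.+-identityʳ w))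
  ... | no  _    = ℚP.≤-trans (ℚP.≤-reflexive (ℚP.+-identityˡ _)) (sumOver-point 0≤w qs!)

  -- Each request to an unmarked page concerns at most one of the distinct candidates and lowers the
  -- count of unmarked pages by one, so the contributions are at most H u, H (u - 1), ..., H 1.
  sumOver-evictionCharge : ∀ u M σ {qs} → Unique qs →
    sumOver qs (evictionCharge u M σ) ℚ.≤ sumH u
  sumOver-evictionCharge zero M σ {qs} qs! = ℚP.≤-reflexive (sumOver-0 qs)
  sumOver-evictionCharge (suc u) M [] {qs} qs! =
    ℚP.≤-trans (ℚP.≤-reflexive (sumOver-0 qs)) (0≤sumH (suc u))
  sumOver-evictionCharge (suc u) M (p ∷ σ) {qs} qs! with p ∈? M
  ... | yes _ = sumOver-evictionCharge (suc u) M σ qs!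
  ... | no  _ = ℚP.≤-trans
    (ℚP.≤-reflexive (sumOver-+ qs (point p (H (suc u))) (evictionCharge u (M ∪ ⁅ p ⁆) σ)))
    (ℚP.+-mono-≤ (sumOver-point (0≤H (suc u)) qs!)
      (sumOver-evictionCharge u (M ∪ ⁅ p ⁆) σ qs!))

module _ (k′ : ℕ) {n : ℕ} where

  -- The weights H i charged from a state with u unmarked pages and marked set M;
  -- C is only consulted outside M, so it may be the cache at the start of the
  -- phase.  The new phase opened at u = 0 starts from cache M.
  charges : ℕ → Subset n → Subset n → List (Fin n) → List ℕ
  charges u C M [] = []
  charges zero C M (p ∷ σ) with p ∈? M
  ... | yes _ = charges zero C M σ
  ... | no  _ = suc k′ ∷ charges k′ M (⊥ ∪ ⁅ p ⁆) σ
  charges (suc u) C M (p ∷ σ) with p ∈? M | p ∈? C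
  ... | yes _ | _     = charges (suc u) C M σ
  ... | no  _ | yes _ = charges u C (M ∪ ⁅ p ⁆) σ
  ... | no  _ | no  _ = suc u ∷ charges u C (M ∪ ⁅ p ⁆) σ

  -- Within the phase only a request to `q` can be charged under `C′` but not under `C`, and
  -- `evictionCharge` pays for it; pages gained by `C′` only remove charges. From the next phase on
  -- the lists agree, as that phase starts from the marked pages in either case.
  weigh-charges-evict : ∀ u C C′ M σ q →
    (∀ {x} → x ∈ C → x ∉ M → x ≢ q → x ∈ C′) →
    weigh (charges u C′ M σ) ℚ.≤ evictionCharge u M σ q ℚ.+ weigh (charges u C M σ)
  weigh-charges-evict zero    C C′ M [] q C⊆ = ℚP.≤-refl
  weigh-charges-evict (suc u) C C′ M [] q C⊆ = ℚP.≤-refl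
  weigh-charges-evict zero C C′ M (p ∷ σ) q C⊆ with p ∈? M
  ... | yes _ = weigh-charges-evict zero C C′ M σ q C⊆
  ... | no  _ = ℚP.≤-reflexive (sym (ℚP.+-identityˡ _))
  weigh-charges-evict (suc u) C C′ M (p ∷ σ) q C⊆ with p ∈? M
  ... | yes _  = weigh-charges-evict (suc u) C C′ M σ q C⊆
  ... | no p∉M with p ∈? C | p ∈? C′
                  | weigh-charges-evict u C C′ (M ∪ ⁅ p ⁆) σ q
                      (λ x∈C x∉M∪p → C⊆ x∈C (x∉M∪p ∘ p⊆p∪q ⁅ p ⁆))
  ...   | yes _ | yes _ | ih = p≤q+r⇒p≤s+q+r (0≤point p q (0≤H (suc u))) ih
  ...   | no _  | no _  | ih = p≤q+r⇒s+p≤t+q+[s+r] (H (suc u)) (0≤point p q (0≤H (suc u))) ih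
  ...   | no _  | yes _ | ih = ℚP.≤-trans (p≤q+p _ (0≤H (suc u)))
    (p≤q+r⇒s+p≤t+q+[s+r] (H (suc u)) (0≤point p q (0≤H (suc u))) ih)
  -- The one case with a new charge: it forces `p` to be `q`, and the `point` term equals the
  -- charge.
  ...   | yes p∈C | no p∉C′ | ih with q ≟ p
  ...     | no q≢p = contradiction (C⊆ p∈C p∉M (q≢p ∘ sym)) p∉C′
  ...     | yes _  = ℚP.≤-trans (ℚP.+-monoʳ-≤ (H (suc u)) ih)
    (ℚP.≤-reflexive (sym (ℚP.+-assoc (H (suc u)) _ _)))

-- Expected cost of marking

expect-costRM : ∀ {n} (s : State {n}) p σ f →
  expect (costRM s (p ∷ σ)) f ≡
  expect (step s p) (λ (c , s′) → expect (costRM s′ σ) (λ c′ → f (c ℕ.+ c′)))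
expect-costRM s p σ f = trans
  (expect->>= (step s p) (λ (c , s′) → costRM s′ σ >>= λ c′ → return (c ℕ.+ c′)) f)
  (expect-cong (step s p) λ (c , s′) → trans
    (expect->>= (costRM s′ σ) (λ c′ → return (c ℕ.+ c′)) f)
    (expect-cong (costRM s′ σ) λ c′ → expect-return (c ℕ.+ c′) f))

module _ (k′ : ℕ) {n : ℕ} where

  costFrom : ℕ → List (Fin n) → ℕ × State {n} → ℚ
  costFrom c σ (c₁ , s) = expect (costRM s σ) (λ c₂ → ι (c ℕ.+ (c₁ ℕ.+ c₂)))

  -- Induction on the requests. The charges are taken relative to the current cache `C`, so an
  -- earlier eviction shows up as a missing page. Keeping the cost `c` paid so far inside the
  -- expectation turns a fault into a step from `c` to `suc c`, without reference to the total
  -- weight of the distribution.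
  expect-costRM-≤ : ∀ σ c C M u → M ⊆ C → ∣ C ∣ ≡ suc k′ → ∣ C ─ M ∣ ≡ u →
    expect (costRM ⟨ C , M ⟩ σ) (λ x → ι (c ℕ.+ x)) ℚ.≤ ι c ℚ.+ weigh (charges k′ u C M σ)

  -- Averaging over the evicted page: each choice `q` costs 1 and adds at most its `evictionCharge`
  -- to the later charges. These add up to at most `sumH u` over the `suc u` choices, and
  -- `sumH-closed` turns the average into `H (suc u)`.
  fault-≤ : ∀ σ c C M u p → M ⊆ C → ∣ C ∣ ≡ suc k′ → ∣ C ─ M ∣ ≡ suc u → p ∉ C →
    expect (uniform (elements (C ─ M)) >>= λ q → return (1 , ⟨ replace C q p , M ∪ ⁅ p ⁆ ⟩))
      (costFrom c σ)
    ℚ.≤ ι c ℚ.+ (H (suc u) ℚ.+ weigh (charges k′ u C (M ∪ ⁅ p ⁆) σ))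

  step-≤ : ∀ σ c C M u p → M ⊆ C → ∣ C ∣ ≡ suc k′ → ∣ C ─ M ∣ ≡ u →
    expect (step ⟨ C , M ⟩ p) (costFrom c σ) ℚ.≤ ι c ℚ.+ weigh (charges k′ u C M (p ∷ σ))

  expect-costRM-≤ [] c C M u M⊆C ∣C∣ ∣C─M∣ = ℚP.≤-reflexive (trans
    (expect-return 0 (λ x → ι (c ℕ.+ x)))
    (trans (cong ι (ℕP.+-identityʳ c)) (sym (ℚP.+-identityʳ (ι c)))))
  expect-costRM-≤ (p ∷ σ) c C M u M⊆C ∣C∣ ∣C─M∣ = ℚP.≤-trans
    (ℚP.≤-reflexive (expect-costRM ⟨ C , M ⟩ p σ (λ x → ι (c ℕ.+ x))))
    (step-≤ σ c C M u p M⊆C ∣C∣ ∣C─M∣)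

  step-≤ σ c C M zero p M⊆C ∣C∣ ∣C─M∣ with p ∈? C | p ∈? M
  ... | yes p∈C | yes p∈M rewrite x∈p⇒p∪x≡p p∈M = ℚP.≤-trans
    (ℚP.≤-reflexive (expect-return (0 , ⟨ C , M ⟩) (costFrom c σ)))
    (expect-costRM-≤ σ c C M zero M⊆C ∣C∣ ∣C─M∣)
  ... | yes p∈C | no p∉M = contradiction
    (trans (sym ∣C─M∣) (x∈p⇒∣p∣≡1+∣p-x∣ (x∈p∧x∉q⇒x∈p─q p∈C p∉M))) λ ()
  ... | no p∉C | yes p∈M = contradiction (M⊆C p∈M) p∉C
  ... | no p∉C | no p∉M with nonempty? (C ─ M)
  ...   | yes (_ , x∈) = contradiction (trans (sym ∣C─M∣) (x∈p⇒∣p∣≡1+∣p-x∣ x∈)) λ ()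
  -- With no unmarked page left, `C` equals `M`. The fault takes place with all `suc k′` pages
  -- unmarked, which matches the restart of `charges` from `M`.
  ...   | no  empty    = ℚP.≤-trans
    (fault-≤ σ c C ⊥ k′ p (⊆-min C) ∣C∣ (trans (cong ∣_∣ (p─⊥≡p C)) ∣C∣) p∉C)
    (ℚP.≤-reflexive (cong (λ S → ι c ℚ.+ (H (suc k′) ℚ.+ weigh (charges k′ k′ S (⊥ ∪ ⁅ p ⁆) σ)))
      (⊆-antisym C⊆M M⊆C)))
    where
    C⊆M : C ⊆ M
    C⊆M {x} x∈C with x ∈? M
    ... | yes x∈M = x∈M
    ... | no  x∉M = contradiction (x , x∈p∧x∉q⇒x∈p─q x∈C x∉M) empty
  step-≤ σ c C M (suc u) p M⊆C ∣C∣ ∣C─M∣ with p ∈? C | p ∈? M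
  ... | yes p∈C | yes p∈M rewrite x∈p⇒p∪x≡p p∈M = ℚP.≤-trans
    (ℚP.≤-reflexive (expect-return (0 , ⟨ C , M ⟩) (costFrom c σ)))
    (expect-costRM-≤ σ c C M (suc u) M⊆C ∣C∣ ∣C─M∣)
  ... | yes p∈C | no p∉M = ℚP.≤-trans
    (ℚP.≤-reflexive (expect-return (0 , ⟨ C , M ∪ ⁅ p ⁆ ⟩) (costFrom c σ)))
    (expect-costRM-≤ σ c C (M ∪ ⁅ p ⁆) u M∪p⊆C ∣C∣ ∣C─M∪p∣)
    where
    M∪p⊆C : M ∪ ⁅ p ⁆ ⊆ C
    M∪p⊆C x∈ with x∈p∪q⁻ M ⁅ p ⁆ x∈
    ... | inj₁ x∈M = M⊆C x∈M
    ... | inj₂ x∈p rewrite x∈⁅y⁆⇒x≡y p x∈p = p∈C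
    ∣C─M∪p∣ : ∣ C ─ (M ∪ ⁅ p ⁆) ∣ ≡ u
    ∣C─M∪p∣ = ℕP.suc-injective (trans
      (trans (cong (suc ∘ ∣_∣) (sym (p─q─r≡p─q∪r C M ⁅ p ⁆)))
        (sym (x∈p⇒∣p∣≡1+∣p-x∣ (x∈p∧x∉q⇒x∈p─q p∈C p∉M))))
      ∣C─M∣)
  ... | no p∉C | yes p∈M = contradiction (M⊆C p∈M) p∉C
  ... | no p∉C | no p∉M with nonempty? (C ─ M)
  ...   | yes _    = fault-≤ σ c C M u p M⊆C ∣C∣ ∣C─M∣ p∉C
  ...   | no empty = contradiction (trans (sym ∣C─M∣)
    (trans (cong ∣_∣ (Empty-unique empty)) (∣⊥∣≡0 n))) λ ()

  fault-≤ σ c C M u p M⊆C ∣C∣ ∣C─M∣ p∉C = begin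
    expect (uniform qs >>= λ q → return (1 , next q)) (costFrom c σ)
      ≡⟨ expect->>= (uniform qs) (λ q → return (1 , next q)) (costFrom c σ) ⟩
    expect (uniform qs) (λ q → expect (return (1 , next q)) (costFrom c σ))
      ≤⟨ expect-uniform-≤ qs _ _ (trans (length-elements (C ─ M)) ∣C─M∣) total ⟩
    ι c ℚ.+ (H (suc u) ℚ.+ W) ∎
    where
    open ℚP.≤-Reasoning
    qs = elements (C ─ M)
    next = λ q → ⟨ replace C q p , M ∪ ⁅ p ⁆ ⟩
    -- The bound for a choice `q` splits into `e q`, which depends on `q`, and the common part `a`.
    e = evictionCharge u (M ∪ ⁅ p ⁆) σ
    W = weigh (charges k′ u C (M ∪ ⁅ p ⁆) σ)
    a = ι (suc c) ℚ.+ W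

    each : ∀ {q} → q ∈ˡ qs → expect (return (1 , next q)) (costFrom c σ) ℚ.≤ e q ℚ.+ a
    each {q} q∈qs = begin
      expect (return (1 , next q)) (costFrom c σ)
        ≡⟨ expect-return (1 , next q) (costFrom c σ) ⟩
      expect (costRM (next q) σ) (λ x → ι (c ℕ.+ suc x))
        ≡⟨ expect-cong (costRM (next q) σ) (λ x → cong ι (ℕP.+-suc c x)) ⟩
      expect (costRM (next q) σ) (λ x → ι (suc c ℕ.+ x))
        ≤⟨ expect-costRM-≤ σ (suc c) (replace C q p) (M ∪ ⁅ p ⁆) u sub
             (trans (∣replace∣ q∈C p∉C) ∣C∣) size ⟩
      ι (suc c) ℚ.+ weigh (charges k′ u (replace C q p) (M ∪ ⁅ p ⁆) σ)
        ≤⟨ ℚP.+-monoʳ-≤ (ι (suc c)) (weigh-charges-evict k′ u C (replace C q p) (M ∪ ⁅ p ⁆) σ q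
             (λ x∈C _ x≢q → p⊆p∪q ⁅ p ⁆ (x∈p∧x≢y⇒x∈p-y x∈C x≢q))) ⟩
      ι (suc c) ℚ.+ (e q ℚ.+ W)
        ≡⟨ solve 3 (λ c e w → c :+ (e :+ w) := e :+ (c :+ w)) refl (ι (suc c)) (e q) W ⟩
      e q ℚ.+ a ∎
      where
      open ℚSolver
      q∈C─M : q ∈ C ─ M
      q∈C─M = proj₂ (∈-filter⁻ (_∈? (C ─ M)) {xs = allFin n} q∈qs)
      q∈C = proj₁ (x∈p─q⁻ C M q∈C─M)
      q∉M = proj₂ (x∈p─q⁻ C M q∈C─M)
      sub : M ∪ ⁅ p ⁆ ⊆ replace C q p
      sub x∈ with x∈p∪q⁻ M ⁅ p ⁆ x∈
      ... | inj₁ x∈M = p⊆p∪q ⁅ p ⁆ (x∈p∧x≢y⇒x∈p-y (M⊆C x∈M) λ { refl → q∉M x∈M })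
      ... | inj₂ x∈p = q⊆p∪q (C - q) ⁅ p ⁆ x∈p
      same : replace C q p ─ (M ∪ ⁅ p ⁆) ≡ C ─ M - q
      same = ⊆-antisym to from
        where
        to : replace C q p ─ (M ∪ ⁅ p ⁆) ⊆ C ─ M - q
        to x∈ with x∈p─q⁻ (replace C q p) (M ∪ ⁅ p ⁆) x∈
        ... | x∈C′ , x∉M′ with x∈p∪q⁻ (C - q) ⁅ p ⁆ x∈C′
        ...   | inj₂ x∈p = contradiction (q⊆p∪q M ⁅ p ⁆ x∈p) x∉M′
        ...   | inj₁ x∈C-q with x∈p-y⁻ C q x∈C-q
        ...     | x∈C , x≢q = x∈p∧x≢y⇒x∈p-y (x∈p∧x∉q⇒x∈p─q x∈C (x∉M′ ∘ p⊆p∪q ⁅ p ⁆)) x≢q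
        from : C ─ M - q ⊆ replace C q p ─ (M ∪ ⁅ p ⁆)
        from x∈ with x∈p-y⁻ (C ─ M) q x∈
        ... | x∈C─M , x≢q with x∈p─q⁻ C M x∈C─M
        ...   | x∈C , x∉M = x∈p∧x∉q⇒x∈p─q (p⊆p∪q ⁅ p ⁆ (x∈p∧x≢y⇒x∈p-y x∈C x≢q)) x∉M′
          where
          x∉M′ : _ ∉ M ∪ ⁅ p ⁆
          x∉M′ x∈M′ with x∈p∪q⁻ M ⁅ p ⁆ x∈M′
          ... | inj₁ x∈M = x∉M x∈M
          ... | inj₂ x∈p = p∉C (subst (_∈ C) (x∈⁅y⁆⇒x≡y p x∈p) x∈C)
      size : ∣ replace C q p ─ (M ∪ ⁅ p ⁆) ∣ ≡ u
      size = ℕP.suc-injective (trans (cong (suc ∘ ∣_∣) same)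
        (trans (sym (x∈p⇒∣p∣≡1+∣p-x∣ q∈C─M)) ∣C─M∣))

    total : sumOver qs (λ q → expect (return (1 , next q)) (costFrom c σ)) ℚ.≤
            ι (suc u) ℚ.* (ι c ℚ.+ (H (suc u) ℚ.+ W))
    total = begin
      sumOver qs (λ q → expect (return (1 , next q)) (costFrom c σ))
        ≤⟨ sumOver-mono qs each ⟩
      sumOver qs (λ q → e q ℚ.+ a)
        ≡⟨ sumOver-+ qs e (λ _ → a) ⟩
      sumOver qs e ℚ.+ sumOver qs (λ _ → a)
        ≤⟨ ℚP.+-monoˡ-≤ _ (sumOver-evictionCharge u (M ∪ ⁅ p ⁆) σ
             (filter⁺ (_∈? (C ─ M)) (allFin⁺ n))) ⟩
      sumH u ℚ.+ sumOver qs (λ _ → a)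
        ≡⟨ cong (sumH u ℚ.+_) (trans (sumOver-const qs a)
             (cong (λ l → ι l ℚ.* a) (trans (length-elements (C ─ M)) ∣C─M∣))) ⟩
      sumH u ℚ.+ ι (suc u) ℚ.* (ι (suc c) ℚ.+ W)
        ≡⟨ cong (λ z → sumH u ℚ.+ ι (suc u) ℚ.* (z ℚ.+ W)) (ι-suc c) ⟩
      sumH u ℚ.+ ι (suc u) ℚ.* (1ℚ ℚ.+ ι c ℚ.+ W)
        ≡⟨ solve 4 (λ s u c w → s :+ u :* (con 1ℚ :+ c :+ w) := u :+ s :+ u :* (c :+ w)) refl
             (sumH u) (ι (suc u)) (ι c) W ⟩
      ι (suc u) ℚ.+ sumH u ℚ.+ ι (suc u) ℚ.* (ι c ℚ.+ W)
        ≡⟨ cong (ℚ._+ ι (suc u) ℚ.* (ι c ℚ.+ W)) (sumH-closed u) ⟩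
      ι (suc u) ℚ.* H (suc u) ℚ.+ ι (suc u) ℚ.* (ι c ℚ.+ W)
        ≡⟨ solve 4 (λ u h c w → u :* h :+ u :* (c :+ w) := u :* (c :+ (h :+ w))) refl
             (ι (suc u)) (H (suc u)) (ι c) W ⟩
      ι (suc u) ℚ.* (ι c ℚ.+ (H (suc u) ℚ.+ W)) ∎
      where open ℚSolver

-- Charges against an offline schedule

-- The first term counts pages whose request would be charged although the offline cache `T` holds
-- them. The second counts marked pages missing from `T`, which turn into such pages when a new
-- phase starts from cache `M`.
potential : ∀ {n} → Subset n → Subset n → Subset n → ℕ
potential P M T = ∣ T ─ (P ∪ M) ∣ ℕ.+ ∣ M ─ T ∣

module _ {n : ℕ} where

  ∣∣-mono : ∀ (A B : Subset n) → A ⊆ B → ∣ A ∣ ≤ ∣ B ∣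
  ∣∣-mono A B A⊆B = p⊆q⇒∣p∣≤∣q∣ A⊆B

  ─-antiʳ : ∀ (A B C : Subset n) → B ⊆ C → A ─ C ⊆ A ─ B
  ─-antiʳ A B C B⊆C x∈ with x∈p─q⁻ A C x∈
  ... | x∈A , x∉C = x∈p∧x∉q⇒x∈p─q x∈A (x∉C ∘ B⊆C)

  ∪-monoʳ : ∀ (P M : Subset n) p → P ∪ M ⊆ P ∪ (M ∪ ⁅ p ⁆)
  ∪-monoʳ P M p x∈ with x∈p∪q⁻ P M x∈
  ... | inj₁ x∈P = p⊆p∪q (M ∪ ⁅ p ⁆) x∈P
  ... | inj₂ x∈M = q⊆p∪q P (M ∪ ⁅ p ⁆) (p⊆p∪q ⁅ p ⁆ x∈M)

  ∪⁅⁆-⊆ : ∀ p (M T : Subset n) → p ∈ T → M ∪ ⁅ p ⁆ ─ T ⊆ M ─ T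
  ∪⁅⁆-⊆ p M T p∈T x∈ with x∈p─q⁻ (M ∪ ⁅ p ⁆) T x∈
  ... | x∈M∪p , x∉T with x∈p∪q⁻ M ⁅ p ⁆ x∈M∪p
  ...   | inj₁ x∈M = x∈p∧x∉q⇒x∈p─q x∈M x∉T
  ...   | inj₂ x∈p = contradiction (subst (_∈ T) (sym (x∈⁅y⁆⇒x≡y p x∈p)) p∈T) x∉T

  potential-hit : ∀ p (P M T : Subset n) → p ∈ T → potential P (M ∪ ⁅ p ⁆) T ≤ potential P M T
  potential-hit p P M T p∈T = ℕP.+-mono-≤
    (∣∣-mono (T ─ (P ∪ (M ∪ ⁅ p ⁆))) (T ─ (P ∪ M))
      (─-antiʳ T (P ∪ M) (P ∪ (M ∪ ⁅ p ⁆)) (∪-monoʳ P M p)))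
    (∣∣-mono (M ∪ ⁅ p ⁆ ─ T) (M ─ T) (∪⁅⁆-⊆ p M T p∈T))

  -- The page `p` leaves `T ─ (P ∪ M)`, and marking it adds nothing to `M ─ T` because `p` lies in
  -- `T`.
  potential-hit-new : ∀ p (P M T : Subset n) → p ∈ T → p ∉ P → p ∉ M →
    suc (potential P (M ∪ ⁅ p ⁆) T) ≤ potential P M T
  potential-hit-new p P M T p∈T p∉P p∉M = ℕP.+-mono-≤
    (p⊂q⇒∣p∣<∣q∣ (─-antiʳ T (P ∪ M) (P ∪ (M ∪ ⁅ p ⁆)) (∪-monoʳ P M p)
      , p , x∈p∧x∉q⇒x∈p─q p∈T p∉P∪M , p∉new))
    (∣∣-mono (M ∪ ⁅ p ⁆ ─ T) (M ─ T) (∪⁅⁆-⊆ p M T p∈T))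
    where
    p∉P∪M : p ∉ P ∪ M
    p∉P∪M p∈ with x∈p∪q⁻ P M p∈
    ... | inj₁ p∈P = p∉P p∈P
    ... | inj₂ p∈M = p∉M p∈M
    p∉new : p ∉ T ─ (P ∪ (M ∪ ⁅ p ⁆))
    p∉new p∈ = proj₂ (x∈p─q⁻ T (P ∪ (M ∪ ⁅ p ⁆)) p∈)
      (q⊆p∪q P (M ∪ ⁅ p ⁆) (q⊆p∪q M ⁅ p ⁆ (x∈⁅x⁆ p)))

  -- The page `p` becomes marked and enters the offline cache at once, so it counts in neither term;
  -- the evicted `q` can only join `M ─ T`.
  potential-fault : ∀ p q (P M T : Subset n) → potential P (M ∪ ⁅ p ⁆) (replace T q p) ≤ suc (potential P M T)
  potential-fault p q P M T = ℕP.≤-trans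
    (ℕP.+-mono-≤ (∣∣-mono (replace T q p ─ (P ∪ (M ∪ ⁅ p ⁆))) (T ─ (P ∪ M)) outer)
      (ℕP.≤-trans (∣∣-mono (M ∪ ⁅ p ⁆ ─ replace T q p) ((M ─ T) ∪ ⁅ q ⁆) inner)
        (∣p∪x∣≤1+∣p∣ (M ─ T) q)))
    (ℕP.≤-reflexive (ℕP.+-suc (∣ T ─ (P ∪ M) ∣) (∣ M ─ T ∣)))
    where
    outer : replace T q p ─ (P ∪ (M ∪ ⁅ p ⁆)) ⊆ T ─ (P ∪ M)
    outer x∈ with x∈p─q⁻ (replace T q p) (P ∪ (M ∪ ⁅ p ⁆)) x∈
    ... | x∈T′ , x∉ with x∈p∪q⁻ (T - q) ⁅ p ⁆ x∈T′
    ...   | inj₁ x∈T-q = x∈p∧x∉q⇒x∈p─q (p─q⊆p T ⁅ q ⁆ x∈T-q) (x∉ ∘ ∪-monoʳ P M p)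
    ...   | inj₂ x∈p   = contradiction (q⊆p∪q P (M ∪ ⁅ p ⁆) (q⊆p∪q M ⁅ p ⁆ x∈p)) x∉
    inner : M ∪ ⁅ p ⁆ ─ replace T q p ⊆ (M ─ T) ∪ ⁅ q ⁆
    inner {x} x∈ with x∈p─q⁻ (M ∪ ⁅ p ⁆) (replace T q p) x∈
    ... | x∈M′ , x∉T′ with x∈p∪q⁻ M ⁅ p ⁆ x∈M′ | x ≟ q
    ...   | inj₂ x∈p | _        = contradiction (q⊆p∪q (T - q) ⁅ p ⁆ x∈p) x∉T′
    ...   | inj₁ x∈M | yes refl = q⊆p∪q (M ─ T) ⁅ q ⁆ (x∈⁅x⁆ q)
    ...   | inj₁ x∈M | no x≢q   = p⊆p∪q ⁅ q ⁆ (x∈p∧x∉q⇒x∈p─q x∈M λ x∈T →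
              x∉T′ (p⊆p∪q ⁅ p ⁆ (x∈p∧x≢y⇒x∈p-y x∈T x≢q)))

  -- Sets of equal size have equally large differences, so the old second term becomes the new first
  -- term, and the new second term vanishes.
  potential-newPhase : ∀ (P M T : Subset n) → ∣ M ∣ ≡ ∣ T ∣ → potential M ⊥ T ≤ potential P M T
  potential-newPhase P M T eq = begin
    ∣ T ─ (M ∪ ⊥) ∣ ℕ.+ ∣ ⊥ ─ T ∣
      ≤⟨ ℕP.+-mono-≤ (∣∣-mono (T ─ (M ∪ ⊥)) (T ─ M) (─-antiʳ T M (M ∪ ⊥) (p⊆p∪q ⊥)))
           (∣p─q∣≤∣p∣ ⊥ T) ⟩
    ∣ T ─ M ∣ ℕ.+ ∣ ⊥ {n} ∣
      ≡⟨ cong₂ ℕ._+_ (sym (∣p∣≡∣q∣⇒∣p─q∣≡∣q─p∣ M T eq)) (∣⊥∣≡0 n) ⟩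
    ∣ M ─ T ∣ ℕ.+ 0
      ≡⟨ ℕP.+-identityʳ (∣ M ─ T ∣) ⟩
    ∣ M ─ T ∣
      ≤⟨ ℕP.m≤n+m (∣ M ─ T ∣) (∣ T ─ (P ∪ M) ∣) ⟩
    potential P M T ∎
    where open ℕP.≤-Reasoning

  potential-initial : ∀ (S : Subset n) → potential S ⊥ S ≡ 0
  potential-initial S = ℕP.n≤0⇒n≡0 (begin
    ∣ S ─ (S ∪ ⊥) ∣ ℕ.+ ∣ ⊥ ─ S ∣
      ≤⟨ ℕP.+-mono-≤ (∣∣-mono (S ─ (S ∪ ⊥)) ⊥ S─S⊆⊥) (∣p─q∣≤∣p∣ ⊥ S) ⟩
    ∣ ⊥ {n} ∣ ℕ.+ ∣ ⊥ {n} ∣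
      ≡⟨ cong₂ ℕ._+_ (∣⊥∣≡0 n) (∣⊥∣≡0 n) ⟩
    0 ∎)
    where
    open ℕP.≤-Reasoning
    S─S⊆⊥ : S ─ (S ∪ ⊥) ⊆ ⊥
    S─S⊆⊥ x∈ with x∈p─q⁻ S (S ∪ ⊥) x∈
    ... | x∈S , x∉ = contradiction (p⊆p∪q ⊥ x∈S) x∉

∣M∪p∣+u : ∀ {n k} (M : Subset n) p u → p ∉ M → ∣ M ∣ ℕ.+ suc u ≡ k →
  ∣ M ∪ ⁅ p ⁆ ∣ ℕ.+ u ≡ k
∣M∪p∣+u M p u p∉M eq = trans (cong (ℕ._+ u) (x∉p⇒∣p∪x∣≡1+∣p∣ p∉M))
  (trans (sym (ℕP.+-suc (∣ M ∣) u)) eq)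

-- An offline fault is worth two units: one for a charge at the request, one for the rise of the
-- potential.
fault-arith : ∀ {l} c φ φ′ → l ≤ 2 ℕ.* c ℕ.+ φ′ → φ′ ≤ suc φ → suc l ≤ 2 ℕ.* suc c ℕ.+ φ
fault-arith {l} c φ φ′ l≤ φ′≤ = begin
  suc l                          ≤⟨ s≤s l≤ ⟩
  suc (2 ℕ.* c ℕ.+ φ′)           ≤⟨ s≤s (ℕP.+-monoʳ-≤ (2 ℕ.* c) φ′≤) ⟩
  suc (2 ℕ.* c ℕ.+ suc φ)
    ≡⟨ solve 2 (λ c φ → con 1 :+ (con 2 :* c :+ (con 1 :+ φ)) := con 2 :* (con 1 :+ c) :+ φ)
         refl c φ ⟩
  2 ℕ.* suc c ℕ.+ φ              ∎
  where
  open ℕP.≤-Reasoning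
  open ℕSolver

module _ (k′ : ℕ) {n : ℕ} where

  -- The request that opens a phase misses the starting cache `M`, so it is charged like any
  -- unmarked request in a phase with nothing marked yet. Hence `unmarked-≤` serves both situations.
  charges-newPhase : ∀ P M (p : Fin n) σ → p ∉ M →
    charges k′ zero P M (p ∷ σ) ≡ charges k′ (suc k′) M ⊥ (p ∷ σ)
  charges-newPhase P M p σ p∉M with p ∈? M | p ∈? ⊥
  ... | yes p∈M | _       = contradiction p∈M p∉M
  ... | no _    | yes p∈⊥ = contradiction p∈⊥ ∉⊥
  ... | no _    | no _    = refl

  charges-marked : ∀ u P M (p : Fin n) σ → p ∈ M → charges k′ u P M (p ∷ σ) ≡ charges k′ u P M σ
  charges-marked zero P M p σ p∈M with p ∈? M
  ... | yes _   = refl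
  ... | no  p∉M = contradiction p∈M p∉M
  charges-marked (suc u) P M p σ p∈M with p ∈? M
  ... | yes _   = refl
  ... | no  p∉M = contradiction p∈M p∉M

  -- Amortised analysis along the schedule: a charge at an offline hit is paid by a drop of
  -- `potential`, one at an offline fault by the fault itself. Here `P` stays fixed during a phase,
  -- and `∣ M ∣ + u` remains the cache size.
  length-charges-≤ : ∀ {T : Subset n} {σ} (s : Schedule T σ) u P M → ∣ T ∣ ≡ suc k′ →
    ∣ M ∣ ℕ.+ u ≡ suc k′ → length (charges k′ u P M σ) ≤ 2 ℕ.* cost s ℕ.+ potential P M T

  marked-≤ : ∀ {T : Subset n} {p σ} (s : Schedule T (p ∷ σ)) u P M → ∣ T ∣ ≡ suc k′ →
    ∣ M ∣ ℕ.+ u ≡ suc k′ → p ∈ M → length (charges k′ u P M σ) ≤ 2 ℕ.* cost s ℕ.+ potential P M T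

  unmarked-≤ : ∀ {T : Subset n} {p σ} (s : Schedule T (p ∷ σ)) u P M → ∣ T ∣ ≡ suc k′ →
    ∣ M ∣ ℕ.+ suc u ≡ suc k′ → p ∉ M →
    length (charges k′ (suc u) P M (p ∷ σ)) ≤ 2 ℕ.* cost s ℕ.+ potential P M T

  length-charges-≤ {σ = []}    s zero    P M ∣T∣ ∣M∣ = z≤n
  length-charges-≤ {σ = []}    s (suc u) P M ∣T∣ ∣M∣ = z≤n
  length-charges-≤ {σ = p ∷ σ} s u P M ∣T∣ ∣M∣ with p ∈? M
  ... | yes p∈M rewrite charges-marked u P M p σ p∈M = marked-≤ s u P M ∣T∣ ∣M∣ p∈M
  length-charges-≤ {σ = p ∷ σ} s (suc u) P M ∣T∣ ∣M∣ | no p∉M =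
    unmarked-≤ s u P M ∣T∣ ∣M∣ p∉M
  length-charges-≤ {T} {p ∷ σ} s zero P M ∣T∣ ∣M∣ | no p∉M
    rewrite charges-newPhase P M p σ p∉M = ℕP.≤-trans
      (unmarked-≤ s k′ M ⊥ ∣T∣ (cong (ℕ._+ suc k′) (∣⊥∣≡0 n)) ∉⊥)
      (ℕP.+-monoʳ-≤ (2 ℕ.* cost s) (potential-newPhase P M T
        (trans (sym (ℕP.+-identityʳ ∣ M ∣)) (trans ∣M∣ (sym ∣T∣)))))

  marked-≤ (hit _ s) u P M ∣T∣ ∣M∣ p∈M = length-charges-≤ s u P M ∣T∣ ∣M∣
  -- No charge is made at a marked page, so one of the two units of the fault is left over.
  marked-≤ {T} {p} (fault p∉T q q∈T s) u P M ∣T∣ ∣M∣ p∈M = ℕP.<⇒≤ (fault-arith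
    (cost s) (potential P M T) (potential P M (replace T q p))
    (length-charges-≤ s u P M (trans (∣replace∣ q∈T p∉T) ∣T∣) ∣M∣)
    (subst (λ M′ → potential P M′ (replace T q p) ≤ suc (potential P M T))
      (x∈p⇒p∪x≡p p∈M) (potential-fault p q P M T)))

  unmarked-≤ {T} {p} (hit p∈T s) u P M ∣T∣ ∣M∣ p∉M with p ∈? M | p ∈? P
  ... | yes p∈M | _      = contradiction p∈M p∉M
  ... | no _    | yes _  = ℕP.≤-trans
    (length-charges-≤ s u P (M ∪ ⁅ p ⁆) ∣T∣ (∣M∪p∣+u M p u p∉M ∣M∣))
    (ℕP.+-monoʳ-≤ (2 ℕ.* cost s) (potential-hit p P M T p∈T))
  ... | no _    | no p∉P = ℕP.≤-trans
    (s≤s (length-charges-≤ s u P (M ∪ ⁅ p ⁆) ∣T∣ (∣M∪p∣+u M p u p∉M ∣M∣)))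
    (ℕP.≤-trans (ℕP.≤-reflexive (sym (ℕP.+-suc (2 ℕ.* cost s) (potential P (M ∪ ⁅ p ⁆) T))))
      (ℕP.+-monoʳ-≤ (2 ℕ.* cost s) (potential-hit-new p P M T p∈T p∉P p∉M)))
  unmarked-≤ {T} {p} {σ} (fault p∉T q q∈T s) u P M ∣T∣ ∣M∣ p∉M = fresh
    where
    served : suc (length (charges k′ u P (M ∪ ⁅ p ⁆) σ)) ≤ 2 ℕ.* suc (cost s) ℕ.+ potential P M T
    served = fault-arith (cost s) (potential P M T) (potential P (M ∪ ⁅ p ⁆) (replace T q p))
      (length-charges-≤ s u P (M ∪ ⁅ p ⁆) (trans (∣replace∣ q∈T p∉T) ∣T∣) (∣M∪p∣+u M p u p∉M ∣M∣))
      (potential-fault p q P M T)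
    fresh : length (charges k′ (suc u) P M (p ∷ σ)) ≤ 2 ℕ.* suc (cost s) ℕ.+ potential P M T
    fresh with p ∈? M | p ∈? P
    ... | yes p∈M | _     = contradiction p∈M p∉M
    ... | no _    | yes _ = ℕP.<⇒≤ served
    ... | no _    | no _  = served

  charges-bounded : ∀ u C M (σ : List (Fin n)) → u ≤ suc k′ → All (_≤ suc k′) (charges k′ u C M σ)
  charges-bounded zero    C M [] u≤k = []
  charges-bounded (suc u) C M [] u≤k = []
  charges-bounded zero C M (p ∷ σ) u≤k with p ∈? M
  ... | yes _ = charges-bounded zero C M σ u≤k
  ... | no  _ = ℕP.≤-refl ∷ charges-bounded k′ M (⊥ ∪ ⁅ p ⁆) σ (ℕP.n≤1+n k′)
  charges-bounded (suc u) C M (p ∷ σ) u≤k with p ∈? M | p ∈? C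
  ... | yes _ | _     = charges-bounded (suc u) C M σ u≤k
  ... | no  _ | yes _ = charges-bounded u C (M ∪ ⁅ p ⁆) σ (ℕP.<⇒≤ u≤k)
  ... | no  _ | no  _ = u≤k ∷ charges-bounded u C (M ∪ ⁅ p ⁆) σ (ℕP.<⇒≤ u≤k)

-- Combination of the online and offline bounds

weigh-≤ : ∀ {k is} → All (_≤ k) is → weigh is ℚ.≤ ι (length is) ℚ.* H k
weigh-≤ {k} {is} is≤k = ℚP.≤-trans
  (sumOver-mono is (λ i∈is → H-mono (All.lookup is≤k i∈is)))
  (ℚP.≤-reflexive (sumOver-const is (H k)))

-- The list of charges depends on the requests alone. Its weight bounds the expected cost, its
-- length is at most twice the cost of any schedule, and each entry weighs at most `H (suc k′)`.
expect-RM≤2*H*cost : ∀ k′ {n} (S : Subset n) → ∣ S ∣ ≡ suc k′ → ∀ {σ} (s : Schedule S σ) →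
  𝔼 (costRM (initial S) σ) ℚ.≤ ι (2 ℕ.* cost s) ℚ.* H (suc k′)
expect-RM≤2*H*cost k′ {n} S ∣S∣ {σ} s = begin
  expect (costRM (initial S) σ) ι
    ≤⟨ expect-costRM-≤ k′ σ 0 S ⊥ (suc k′) (⊆-min S) ∣S∣ (trans (cong ∣_∣ (p─⊥≡p S)) ∣S∣) ⟩
  0ℚ ℚ.+ weigh is
    ≡⟨ ℚP.+-identityˡ (weigh is) ⟩
  weigh is
    ≤⟨ weigh-≤ (charges-bounded k′ (suc k′) S ⊥ σ ℕP.≤-refl) ⟩
  ι (length is) ℚ.* H (suc k′)
    ≤⟨ ℚP.*-monoʳ-≤-nonNeg (H (suc k′)) {{ℚ.nonNegative (0≤H (suc k′))}} (ι-mono charged) ⟩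
  ι (2 ℕ.* cost s) ℚ.* H (suc k′) ∎
  where
  open ℚP.≤-Reasoning
  is = charges k′ (suc k′) S ⊥ σ
  charged : length is ≤ 2 ℕ.* cost s
  charged = ℕP.≤-trans
    (length-charges-≤ k′ s (suc k′) S ⊥ ∣S∣ (cong (ℕ._+ suc k′) (∣⊥∣≡0 n)))
    (ℕP.≤-reflexive (trans (cong (2 ℕ.* cost s ℕ.+_) (potential-initial S)) (ℕP.+-identityʳ _)))

theorem29 : ∃[ C ] ((k n : ℕ) → 1 ≤ k →
    ∃[ b ] ((S₀ : Subset n) → ∣ S₀ ∣ ≡ k →
    (σ : List (Fin n)) (opt : ℕ) → IsOptCost S₀ σ opt →
    fromℚ (𝔼 (costRM (initial S₀) σ)) ≤ℝ C *ℝ ln (suc k) *ℝ fromℕ opt +ℝ b))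
-- The constant 4 is 2 charges per unit of offline cost times the factor 2 between `H` and the
-- logarithm. The additive constant is 0 because both algorithms start from the same cache, where
-- the potential is 0. The inequality holds at every index of the Riemann sums, hence the threshold
-- 0.
theorem29 = fromℕ 4 , λ { (suc k′) n _ → fromℕ 0 , λ { S ∣S∣ σ opt ((s , refl) , _) ε 0<ε → 0 , λ m _ →
  let R = riemann (suc (suc k′)) m in begin
  𝔼 (costRM (initial S) σ)
    ≤⟨ expect-RM≤2*H*cost k′ S ∣S∣ s ⟩
  ι (2 ℕ.* cost s) ℚ.* H (suc k′)
    ≤⟨ ℚP.*-monoˡ-≤-nonNeg (ι (2 ℕ.* cost s)) {{ι-nonNeg (2 ℕ.* cost s)}} (H≤2*riemann (suc k′) m) ⟩
  ι (2 ℕ.* cost s) ℚ.* (ι 2 ℚ.* R)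
    ≡⟨ cong (ℚ._* (ι 2 ℚ.* R)) (ι-homo-* 2 (cost s)) ⟩
  ι 2 ℚ.* ι (cost s) ℚ.* (ι 2 ℚ.* R)
    ≡⟨ solve 2 (λ c r → con (ι 2) :* c :* (con (ι 2) :* r) := con (ι 4) :* r :* c :+ con 0ℚ)
         refl (ι (cost s)) R ⟩
  ι 4 ℚ.* R ℚ.* ι (cost s) ℚ.+ 0ℚ
    ≤⟨ p≤q+p _ (ℚP.<⇒≤ 0<ε) ⟩
  ε ℚ.+ (ι 4 ℚ.* R ℚ.* ι (cost s) ℚ.+ 0ℚ)
    ≡⟨ ℚP.+-comm ε _ ⟩
  ι 4 ℚ.* R ℚ.* ι (cost s) ℚ.+ 0ℚ ℚ.+ ε ∎ } }
  where
  open ℚP.≤-Reasoning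
  open ℚSolver
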